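{- The bigraded Hopf algebra $\mathrm{DNSym}$ is isomorphic to the bigraded Hopf dual algebra $\mathrm{DQSym}^*=\bigoplus_{(d_1,d_2)}\bigl(\mathrm{DQSym}^{(d_1,d_2)}\bigr)^*$ of $\mathrm{DQSym}$.
   Context: All vector spaces are over $\mathbb{Q}$, and $0\in\mathbb{N}$. Definition of $\mathrm{DNSym}$. $\mathrm{DNSym}:=\mathbb{Q}\langle \mathfrak h_\alpha\mid \alpha\in\mathbb{N}^2\setminus\{0\}\rangle$ is the free associative (noncommutative) unital algebra on variables $\mathfrak h_\alpha$, bigraded by giving $\mathfrak h_\alpha$ bidegree $\alpha=(a,b)$. With the convention $\mathfrak h_0:=1$, its comultiplication is the algebra morphism determined by $$\Delta(\mathfrak h_\alpha)=\sum_{\alpha=\beta+\gamma}\mathfrak h_\beta\otimes\mathfrak h_\gamma,$$ the sum being over all pairs $\beta,\gamma\in\mathbb{N}^2$ with vector sum $\alpha$, and its counit is the algebra morphism determined by $\epsilon(\mathfrak h_\alpha)=1$ if $\alpha=0$ and $0$ otherwise. This makes $\mathrm{DNSym}$ a bigraded Hopf algebra. Definition of $\mathrm{DQSym}$. A bicomposition of length $k$ is a sequence $\mathfrak a=(\alpha_1,\dots,\alpha_k)$ of nonzero vectors $\alpha_m=(a_m,b_m)\in\mathbb{N}^2$; the empty bicomposition, of length $0$, is denoted $0$. The bidegree of $\mathfrak a$ is $d(\mathfrak a)=(a_1+\dots+a_k,\;b_1+\dots+b_k)$. Concatenation is $(\alpha_1,\dots,\alpha_k)\cdot(\beta_1,\dots,\beta_\ell)=(\alpha_1,\dots,\alpha_k,\beta_1,\dots,\beta_\ell)$.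 In two infinite sets of commuting variables $x_1,x_2,\dots$ and $y_1,y_2,\dots$, define the formal series $$M_{\mathfrak a}=\sum_{i_1<i_2<\dots<i_k} x_{i_1}^{a_1}y_{i_1}^{b_1}\cdots x_{i_k}^{a_k}y_{i_k}^{b_k},\qquad M_0=1.$$ $\mathrm{DQSym}$ is the vector space with basis $\{M_{\mathfrak a}\}$, $\mathfrak a$ running over all bicompositions, with the usual multiplication of formal series (under which it is closed), unit $M_0=1$, comultiplication $\Delta(M_{\mathfrak a})=\sum_{\mathfrak a_1\cdot\mathfrak a_2=\mathfrak a}M_{\mathfrak a_1}\otimes M_{\mathfrak a_2}$ (sum over all factorizations, including those with an empty factor), and counit $\epsilon(M_{\mathfrak a})=1$ if $\mathfrak a=0$ and $0$ otherwise. It is a bigraded Hopf algebra, $M_{\mathfrak a}$ having bidegree $d(\mathfrak a)$; its bihomogeneous component $\mathrm{DQSym}^{(d_1,d_2)}$ is the finite-dimensional span of the $M_{\mathfrak a}$ with $d(\mathfrak a)=(d_1,d_2)$. The bigraded Hopf dual $\mathrm{DQSym}^*$ is the direct sum of the linear duals of the bihomogeneous components, with multiplication dual to the comultiplication of $\mathrm{DQSym}$ and comultiplication dual to the multiplication of $\mathrm{DQSym}$. "Isomorphic" means isomorphic as bigraded Hopf algebras. -}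

module Defs where

open import Algebra.Module.Bundles using (Module)
import Algebra.Module.Construct.TensorUnit as TensorUnit
open import Algebra.Module.Morphism.Structures using (module ModuleMorphisms)
open import Algebra.Module.Structures using (IsModule)
open import Algebra.Module.Structures.Biased using (IsModuleFromLeft)
import Algebra.Properties.CommutativeSemigroup as CommutativeSemigroupProperties
import Algebra.Properties.Group as GroupProperties
open import Data.Bool.Base using (if_then_else_)
open import Data.Empty using (⊥; ⊥-elim-irr)
open import Data.Irrelevant using ([_])
open import Data.List.Base
  using (List; []; _∷_; _++_; map; foldr; length; upTo; cartesianProduct; cartesianProductWith;
         deduplicate)
import Data.List.Membership.DecPropositional as DecMembership
open import Data.List.Membership.Propositional using (_∈_; _∉_)
open import Data.List.Membership.Propositional.Properties
  using (∈-map⁺; ∈-map⁻; ∈-++⁺ˡ; ∈-++⁺ʳ; ∈-upTo⁺; ∈-upTo⁻; ∈-cartesianProduct⁺;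
         ∈-cartesianProductWith⁺; ∈-cartesianProductWith⁻; ∈-deduplicate⁺)
import Data.List.Properties as List
open import Data.List.Relation.Unary.All as All using (All; []; _∷_)
open import Data.List.Relation.Unary.AllPairs using ([]; _∷_)
open import Data.List.Relation.Unary.Any using (here; there)
import Data.List.Relation.Unary.Unique.DecPropositional.Properties as DecUnique
open import Data.List.Relation.Unary.Unique.Propositional using (Unique)
open import Data.List.Relation.Unary.Unique.Propositional.Properties as Unique
  using (upTo⁺; cartesianProduct⁺; cartesianProductWith⁺)
open import Data.Nat.Base as ℕ using (ℕ; zero; suc; _∸_; _≤_; _⊔_; z≤n; s≤s)
import Data.Nat.Properties as ℕₚ
open import Data.Product.Base using (∃; _×_; _,_; proj₁; proj₂)
import Data.Product.Properties as Product
open import Data.Rational.Base using (ℚ; 0ℚ; 1ℚ; _+_; _*_; -_)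
import Data.Rational.Properties as ℚₚ
open import Data.Refinement.Base using (Refinement-syntax; value; _,_)
import Data.Refinement.Properties as Refinement
open import Data.Sum.Base using (_⊎_; inj₁; inj₂)
open import Function.Base using (_∘_; id; flip)
open import Function.Bundles using (_⇔_)
open import Level using (0ℓ)
open import Relation.Binary.Definitions using (DecidableEquality)
open import Relation.Binary.PropositionalEquality
  using (_≡_; _≢_; refl; sym; trans; cong; cong₂; subst; module ≡-Reasoning)
import Relation.Binary.Reasoning.Setoid as SetoidReasoning
open import Relation.Nullary using (Dec; yes; no; ¬_; contradiction)
open import Relation.Nullary.Decidable.Core using (does)

ℚ-Space : Set₁
ℚ-Space = Module ℚₚ.+-*-commutativeRing 0ℓ 0ℓ

∥_∥ : ℚ-Space → Set
∥ V ∥ = Module.Carrierᴹ V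

𝕜 : ℚ-Space
𝕜 = TensorUnit.⟨module⟩ {R = ℚₚ.+-*-commutativeRing}

-- Negation is scalar multiplication by -1.
record SpaceAxioms {A : Set} (_≈_ : A → A → Set) (_⊞_ : A → A → A) (𝟘 : A)
                   (_⊡_ : ℚ → A → A) : Set where
  field
    ≈-refl      : ∀ {x} → x ≈ x
    ≈-sym       : ∀ {x y} → x ≈ y → y ≈ x
    ≈-trans     : ∀ {x y z} → x ≈ y → y ≈ z → x ≈ z
    ⊞-cong      : ∀ {x x′ y y′} → x ≈ x′ → y ≈ y′ → (x ⊞ y) ≈ (x′ ⊞ y′)
    ⊡-cong      : ∀ r {x x′} → x ≈ x′ → (r ⊡ x) ≈ (r ⊡ x′)
    ⊞-assoc     : ∀ x y z → ((x ⊞ y) ⊞ z) ≈ (x ⊞ (y ⊞ z))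
    ⊞-comm      : ∀ x y → (x ⊞ y) ≈ (y ⊞ x)
    ⊞-identityˡ : ∀ x → (𝟘 ⊞ x) ≈ x
    ⊡-distribˡ  : ∀ r x y → (r ⊡ (x ⊞ y)) ≈ ((r ⊡ x) ⊞ (r ⊡ y))
    ⊡-distribʳ  : ∀ r s x → ((r + s) ⊡ x) ≈ ((r ⊡ x) ⊞ (s ⊡ x))
    ⊡-assoc     : ∀ r s x → ((r * s) ⊡ x) ≈ (r ⊡ (s ⊡ x))
    ⊡-identity  : ∀ x → (1ℚ ⊡ x) ≈ x
    ⊡-zero      : ∀ x → (0ℚ ⊡ x) ≈ 𝟘

  private
    ⊡-congʳ : ∀ {r s} x → r ≡ s → (r ⊡ x) ≈ (s ⊡ x)
    ⊡-congʳ x refl = ≈-refl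

    zeroʳ : ∀ r → (r ⊡ 𝟘) ≈ 𝟘
    zeroʳ r = ≈-trans (⊡-cong r (≈-sym (⊡-zero 𝟘)))
             (≈-trans (≈-sym (⊡-assoc r 0ℚ 𝟘))
             (≈-trans (⊡-congʳ 𝟘 (ℚₚ.*-zeroʳ r)) (⊡-zero 𝟘)))

    inverseʳ : ∀ x → (x ⊞ ((- 1ℚ) ⊡ x)) ≈ 𝟘
    inverseʳ x = ≈-trans (⊞-cong (≈-sym (⊡-identity x)) ≈-refl)
                (≈-trans (≈-sym (⊡-distribʳ 1ℚ (- 1ℚ) x)) (⊡-zero x))

  opaque
    isModule : IsModule ℚₚ.+-*-commutativeRing _≈_ _⊞_ 𝟘 ((- 1ℚ) ⊡_) _⊡_ (flip _⊡_)
    isModule = IsModuleFromLeft.isModule {commutativeRing = ℚₚ.+-*-commutativeRing} (record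
      { isLeftModule = record
        { isLeftSemimodule = record
          { +ᴹ-isCommutativeMonoid = record
            { isMonoid = record
              { isSemigroup = record
                { isMagma = record
                  { isEquivalence = record { refl = ≈-refl ; sym = ≈-sym ; trans = ≈-trans }
                  ; ∙-cong = ⊞-cong }
                ; assoc = ⊞-assoc }
              ; identity = ⊞-identityˡ , λ x → ≈-trans (⊞-comm x 𝟘) (⊞-identityˡ x) }
            ; comm = ⊞-comm }
          ; isPreleftSemimodule = record
            { *ₗ-cong = λ { {x = r} refl p → ⊡-cong r p }
            ; *ₗ-zeroˡ = ⊡-zero
            ; *ₗ-distribʳ = λ x r s → ⊡-distribʳ r s x
            ; *ₗ-identityˡ = ⊡-identity
            ; *ₗ-assoc = ⊡-assoc
            ; *ₗ-zeroʳ = zeroʳ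
            ; *ₗ-distribˡ = ⊡-distribˡ } }
        ; -ᴹ‿cong = ⊡-cong (- 1ℚ)
        ; -ᴹ‿inverse = (λ x → ≈-trans (⊞-comm _ x) (inverseʳ x)) , inverseʳ } })

  space : ℚ-Space
  space = record
    { Carrierᴹ = A ; _≈ᴹ_ = _≈_ ; _+ᴹ_ = _⊞_ ; _*ₗ_ = _⊡_ ; _*ᵣ_ = flip _⊡_
    ; 0ᴹ = 𝟘 ; -ᴹ_ = (- 1ℚ) ⊡_ ; isModule = isModule }

module _ (V W : ℚ-Space) where
  private
    module V = Module V
    module W = Module W

  IsLinear : (∥ V ∥ → ∥ W ∥) → Set
  IsLinear = ModuleMorphisms.IsModuleHomomorphism V.rawModule W.rawModule

  infixr 3 _⊸_
  record _⊸_ : Set where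
    constructor mk⊸
    field
      to       : ∥ V ∥ → ∥ W ∥
      isLinear : IsLinear to

module _ {V W : ℚ-Space} where
  private
    module V = Module V
    module W = Module W

  infixl 9 _$_
  _$_ : (V ⊸ W) → ∥ V ∥ → ∥ W ∥
  _$_ = _⊸_.to

  module Lin (f : V ⊸ W) where
    open ModuleMorphisms.IsModuleHomomorphism (_⊸_.isLinear f) public
      using (⟦⟧-cong; +ᴹ-homo; 0ᴹ-homo; *ₗ-homo)

  linear : (f : ∥ V ∥ → ∥ W ∥) →
           (∀ {x y} → x V.≈ᴹ y → f x W.≈ᴹ f y) →
           (∀ x y → f (x V.+ᴹ y) W.≈ᴹ (f x W.+ᴹ f y)) →
           (∀ r x → f (r V.*ₗ x) W.≈ᴹ (r W.*ₗ f x)) →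
           V ⊸ W
  linear f f-cong f-+ f-* = mk⊸ f (record
    { isBimoduleHomomorphism = record
      { +ᴹ-isGroupHomomorphism = record
        { isMonoidHomomorphism = record
          { isMagmaHomomorphism = record
            { isRelHomomorphism = record { cong = f-cong } ; homo = f-+ }
          ; ε-homo = f-0 }
        ; ⁻¹-homo = f-neg }
      ; *ₗ-homo = f-*
      ; *ᵣ-homo = λ r x → W.≈ᴹ-trans (f-cong (V.≈ᴹ-sym (V.*ₗ-*ᵣ-coincident r x)))
                         (W.≈ᴹ-trans (f-* r x) (W.*ₗ-*ᵣ-coincident r (f x))) } })
    where
    f-0 : f V.0ᴹ W.≈ᴹ W.0ᴹ
    f-0 = W.≈ᴹ-trans (f-cong (V.≈ᴹ-sym (V.*ₗ-zeroˡ V.0ᴹ)))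
         (W.≈ᴹ-trans (f-* 0ℚ V.0ᴹ) (W.*ₗ-zeroˡ (f V.0ᴹ)))
    f-neg : ∀ x → f (V.-ᴹ x) W.≈ᴹ (W.-ᴹ f x)
    f-neg x = GroupProperties.inverseʳ-unique W.+ᴹ-group (f x) (f (V.-ᴹ x))
      (W.≈ᴹ-trans (W.≈ᴹ-sym (f-+ x (V.-ᴹ x)))
      (W.≈ᴹ-trans (f-cong (V.-ᴹ‿inverseʳ x)) f-0))

module SpaceLemmas (W : ℚ-Space) where
  open Module W

  interchange : ∀ a b c d → ((a +ᴹ b) +ᴹ (c +ᴹ d)) ≈ᴹ ((a +ᴹ c) +ᴹ (b +ᴹ d))
  interchange a b c d = begin
    (a +ᴹ b) +ᴹ (c +ᴹ d)  ≈⟨ +ᴹ-assoc a b _ ⟩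
    a +ᴹ (b +ᴹ (c +ᴹ d))  ≈⟨ +ᴹ-congˡ (≈ᴹ-sym (+ᴹ-assoc b c d)) ⟩
    a +ᴹ ((b +ᴹ c) +ᴹ d)  ≈⟨ +ᴹ-congˡ (+ᴹ-congʳ (+ᴹ-comm b c)) ⟩
    a +ᴹ ((c +ᴹ b) +ᴹ d)  ≈⟨ +ᴹ-congˡ (+ᴹ-assoc c b d) ⟩
    a +ᴹ (c +ᴹ (b +ᴹ d))  ≈⟨ ≈ᴹ-sym (+ᴹ-assoc a c _) ⟩
    (a +ᴹ c) +ᴹ (b +ᴹ d)  ∎
    where open SetoidReasoning ≈ᴹ-setoid

  *ₗ-swap : ∀ r s x → (r *ₗ (s *ₗ x)) ≈ᴹ (s *ₗ (r *ₗ x))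
  *ₗ-swap r s x = ≈ᴹ-trans (≈ᴹ-sym (*ₗ-assoc r s x))
    (≈ᴹ-trans (*ₗ-cong (ℚₚ.*-comm r s) ≈ᴹ-refl) (*ₗ-assoc s r x))

module _ (V W : ℚ-Space) where
  private
    module V = Module V
    module W = Module W
    open SpaceLemmas W

  Hom : ℚ-Space
  Hom = SpaceAxioms.space {A = V ⊸ W}
    {_≈_ = λ f g → ∀ x → f $ x W.≈ᴹ g $ x}
    {_⊞_ = λ f g → linear (λ x → f $ x W.+ᴹ g $ x)
      (λ p → W.+ᴹ-cong (Lin.⟦⟧-cong f p) (Lin.⟦⟧-cong g p))
      (λ x y → W.≈ᴹ-trans (W.+ᴹ-cong (Lin.+ᴹ-homo f x y) (Lin.+ᴹ-homo g x y))
                          (interchange (f $ x) (f $ y) (g $ x) (g $ y)))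
      (λ r x → W.≈ᴹ-trans (W.+ᴹ-cong (Lin.*ₗ-homo f r x) (Lin.*ₗ-homo g r x))
                          (W.≈ᴹ-sym (W.*ₗ-distribˡ r (f $ x) (g $ x))))}
    {𝟘 = linear (λ _ → W.0ᴹ) (λ _ → W.≈ᴹ-refl)
      (λ _ _ → W.≈ᴹ-sym (W.+ᴹ-identityˡ W.0ᴹ)) (λ r _ → W.≈ᴹ-sym (W.*ₗ-zeroʳ r))}
    {_⊡_ = λ r f → linear (λ x → r W.*ₗ f $ x)
      (λ p → W.*ₗ-congˡ (Lin.⟦⟧-cong f p))
      (λ x y → W.≈ᴹ-trans (W.*ₗ-congˡ (Lin.+ᴹ-homo f x y)) (W.*ₗ-distribˡ r (f $ x) (f $ y)))
      (λ s x → W.≈ᴹ-trans (W.*ₗ-congˡ (Lin.*ₗ-homo f s x)) (*ₗ-swap r s (f $ x)))}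
    (record
      { ≈-refl      = λ _ → W.≈ᴹ-refl
      ; ≈-sym       = λ p x → W.≈ᴹ-sym (p x)
      ; ≈-trans     = λ p q x → W.≈ᴹ-trans (p x) (q x)
      ; ⊞-cong      = λ p q x → W.+ᴹ-cong (p x) (q x)
      ; ⊡-cong      = λ r p x → W.*ₗ-congˡ (p x)
      ; ⊞-assoc     = λ f g h x → W.+ᴹ-assoc (f $ x) (g $ x) (h $ x)
      ; ⊞-comm      = λ f g x → W.+ᴹ-comm (f $ x) (g $ x)
      ; ⊞-identityˡ = λ f x → W.+ᴹ-identityˡ (f $ x)
      ; ⊡-distribˡ  = λ r f g x → W.*ₗ-distribˡ r (f $ x) (g $ x)
      ; ⊡-distribʳ  = λ r s f x → W.*ₗ-distribʳ (f $ x) r s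
      ; ⊡-assoc     = λ r s f x → W.*ₗ-assoc r s (f $ x)
      ; ⊡-identity  = λ f x → W.*ₗ-identityˡ (f $ x)
      ; ⊡-zero      = λ f x → W.*ₗ-zeroˡ (f $ x)
      })

Dual : ℚ-Space → ℚ-Space
Dual V = Hom V 𝕜

infixr 9 _∘ₗ_
_∘ₗ_ : {U V W : ℚ-Space} → (V ⊸ W) → (U ⊸ V) → (U ⊸ W)
_∘ₗ_ {U} {V} {W} g f = linear (λ x → g $ (f $ x))
  (λ p → Lin.⟦⟧-cong g (Lin.⟦⟧-cong f p))
  (λ x y → W.≈ᴹ-trans (Lin.⟦⟧-cong g (Lin.+ᴹ-homo f x y)) (Lin.+ᴹ-homo g _ _))
  (λ r x → W.≈ᴹ-trans (Lin.⟦⟧-cong g (Lin.*ₗ-homo f r x)) (Lin.*ₗ-homo g r _))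
  where module W = Module W

Bilinear : ℚ-Space → ℚ-Space → ℚ-Space → Set
Bilinear U V W = U ⊸ Hom V W

module _ {U V W : ℚ-Space} where
  private
    module U = Module U
    module V = Module V
    module W = Module W

  bilinear : (f : ∥ U ∥ → ∥ V ∥ → ∥ W ∥) →
             (∀ {x x′ y y′} → x U.≈ᴹ x′ → y V.≈ᴹ y′ → f x y W.≈ᴹ f x′ y′) →
             (∀ x x′ y → f (x U.+ᴹ x′) y W.≈ᴹ (f x y W.+ᴹ f x′ y)) →
             (∀ r x y → f (r U.*ₗ x) y W.≈ᴹ (r W.*ₗ f x y)) →
             (∀ x y y′ → f x (y V.+ᴹ y′) W.≈ᴹ (f x y W.+ᴹ f x y′)) →
             (∀ x r y → f x (r V.*ₗ y) W.≈ᴹ (r W.*ₗ f x y)) →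
             Bilinear U V W
  bilinear f f-cong f-+ˡ f-*ˡ f-+ʳ f-*ʳ = linear
    (λ x → linear (f x) (f-cong U.≈ᴹ-refl) (f-+ʳ x) (f-*ʳ x))
    (λ p y → f-cong p V.≈ᴹ-refl)
    f-+ˡ f-*ˡ

-- The ℚ-vector space with generators G and relations R: formal linear
-- combinations modulo the least congruence containing R and the axioms of
-- a vector space.
data Combination (G : Set) : Set where
  gen  : G → Combination G
  𝟘    : Combination G
  _⊞_  : Combination G → Combination G → Combination G
  _⊡_  : ℚ → Combination G → Combination G

infixl 6 _⊞_
infixr 7 _⊡_

module Presented {G : Set} (R : Combination G → Combination G → Set) where

  infix 4 _≋_
  data _≋_ : Combination G → Combination G → Set where
    relation    : ∀ {x y} → R x y → x ≋ y
    ≋-refl      : ∀ {x} → x ≋ x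
    ≋-sym       : ∀ {x y} → x ≋ y → y ≋ x
    ≋-trans     : ∀ {x y z} → x ≋ y → y ≋ z → x ≋ z
    ⊞-cong      : ∀ {x x′ y y′} → x ≋ x′ → y ≋ y′ → x ⊞ y ≋ x′ ⊞ y′
    ⊡-cong      : ∀ r {x x′} → x ≋ x′ → r ⊡ x ≋ r ⊡ x′
    ⊞-assoc     : ∀ x y z → (x ⊞ y) ⊞ z ≋ x ⊞ (y ⊞ z)
    ⊞-comm      : ∀ x y → x ⊞ y ≋ y ⊞ x
    ⊞-identityˡ : ∀ x → 𝟘 ⊞ x ≋ x
    ⊡-distribˡ  : ∀ r x y → r ⊡ (x ⊞ y) ≋ r ⊡ x ⊞ r ⊡ y
    ⊡-distribʳ  : ∀ r s x → (r + s) ⊡ x ≋ r ⊡ x ⊞ s ⊡ x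
    ⊡-assoc     : ∀ r s x → (r * s) ⊡ x ≋ r ⊡ s ⊡ x
    ⊡-identity  : ∀ x → 1ℚ ⊡ x ≋ x
    ⊡-zero      : ∀ x → 0ℚ ⊡ x ≋ 𝟘

  space : ℚ-Space
  space = SpaceAxioms.space {_≈_ = _≋_} {_⊞_ = _⊞_} {𝟘 = 𝟘} {_⊡_ = _⊡_} (record
    { ≈-refl = ≋-refl ; ≈-sym = ≋-sym ; ≈-trans = ≋-trans
    ; ⊞-cong = ⊞-cong ; ⊡-cong = ⊡-cong ; ⊞-assoc = ⊞-assoc ; ⊞-comm = ⊞-comm
    ; ⊞-identityˡ = ⊞-identityˡ ; ⊡-distribˡ = ⊡-distribˡ ; ⊡-distribʳ = ⊡-distribʳ
    ; ⊡-assoc = ⊡-assoc ; ⊡-identity = ⊡-identity ; ⊡-zero = ⊡-zero })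

module _ {G : Set} (W : ℚ-Space) (k : G → ∥ W ∥) where
  private module W = Module W

  evaluate : Combination G → ∥ W ∥
  evaluate (gen g) = k g
  evaluate 𝟘       = W.0ᴹ
  evaluate (x ⊞ y) = evaluate x W.+ᴹ evaluate y
  evaluate (r ⊡ x) = r W.*ₗ evaluate x

  module _ (R : Combination G → Combination G → Set)
           (respects : ∀ {x y} → R x y → evaluate x W.≈ᴹ evaluate y) where
    open Presented R

    evaluate-cong : ∀ {x y} → x ≋ y → evaluate x W.≈ᴹ evaluate y
    evaluate-cong (relation p)         = respects p
    evaluate-cong ≋-refl               = W.≈ᴹ-refl
    evaluate-cong (≋-sym p)            = W.≈ᴹ-sym (evaluate-cong p)
    evaluate-cong (≋-trans p q)        = W.≈ᴹ-trans (evaluate-cong p) (evaluate-cong q)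
    evaluate-cong (⊞-cong p q)         = W.+ᴹ-cong (evaluate-cong p) (evaluate-cong q)
    evaluate-cong (⊡-cong r p)         = W.*ₗ-congˡ (evaluate-cong p)
    evaluate-cong (⊞-assoc x y z)      = W.+ᴹ-assoc _ _ _
    evaluate-cong (⊞-comm x y)         = W.+ᴹ-comm _ _
    evaluate-cong (⊞-identityˡ x)      = W.+ᴹ-identityˡ _
    evaluate-cong (⊡-distribˡ r x y)   = W.*ₗ-distribˡ r _ _
    evaluate-cong (⊡-distribʳ r s x)   = W.*ₗ-distribʳ _ r s
    evaluate-cong (⊡-assoc r s x)      = W.*ₗ-assoc r s _
    evaluate-cong (⊡-identity x)       = W.*ₗ-identityˡ _
    evaluate-cong (⊡-zero x)           = W.*ₗ-zeroˡ _

    extend : space ⊸ W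
    extend = linear evaluate evaluate-cong (λ _ _ → W.≈ᴹ-refl) (λ _ _ → W.≈ᴹ-refl)

Free : Set → ℚ-Space
Free B = Presented.space {B} (λ _ _ → ⊥)

extendFree : {B : Set} {W : ℚ-Space} → (B → ∥ W ∥) → Free B ⊸ W
extendFree {W = W} k = extend W k (λ _ _ → ⊥) (λ ())

module _ (V W : ℚ-Space) where
  private
    module V = Module V
    module W = Module W

  data Bilinearity : (x y : Combination (∥ V ∥ × ∥ W ∥)) → Set where
    cong-⊗ : ∀ {v v′ w w′} → v V.≈ᴹ v′ → w W.≈ᴹ w′ → Bilinearity (gen (v , w)) (gen (v′ , w′))
    +-⊗    : ∀ v v′ w → Bilinearity (gen (v V.+ᴹ v′ , w)) (gen (v , w) ⊞ gen (v′ , w))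
    *-⊗    : ∀ r v w → Bilinearity (gen (r V.*ₗ v , w)) (r ⊡ gen (v , w))
    ⊗-+    : ∀ v w w′ → Bilinearity (gen (v , w W.+ᴹ w′)) (gen (v , w) ⊞ gen (v , w′))
    ⊗-*    : ∀ v r w → Bilinearity (gen (v , r W.*ₗ w)) (r ⊡ gen (v , w))

  infixr 5 _⊗_
  _⊗_ : ℚ-Space
  _⊗_ = Presented.space Bilinearity

infixr 5 _⊗ₑ_
_⊗ₑ_ : {A B : Set} → A → B → Combination (A × B)
v ⊗ₑ w = gen (v , w)

uncurry⊗ : {U V W : ℚ-Space} → Bilinear U V W → U ⊗ V ⊸ W
uncurry⊗ {U} {V} {W} f = extend W (λ (u , v) → f $ u $ v) (Bilinearity U V) respects
  where
  module W = Module W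
  respects : ∀ {x y} → Bilinearity U V x y →
             evaluate W (λ (u , v) → f $ u $ v) x W.≈ᴹ evaluate W (λ (u , v) → f $ u $ v) y
  respects (cong-⊗ {v′ = v′} {w} p q) =
    W.≈ᴹ-trans (Lin.⟦⟧-cong f p w) (Lin.⟦⟧-cong (f $ v′) q)
  respects (+-⊗ v v′ w) = Lin.+ᴹ-homo f v v′ w
  respects (*-⊗ r v w)  = Lin.*ₗ-homo f r v w
  respects (⊗-+ v w w′) = Lin.+ᴹ-homo (f $ v) w w′
  respects (⊗-* v r w)  = Lin.*ₗ-homo (f $ v) r w

tensor : {U U′ V V′ : ℚ-Space} → (U ⊸ U′) → (V ⊸ V′) → U ⊗ V ⊸ U′ ⊗ V′
tensor {U} {U′} {V} {V′} f g = uncurry⊗ {U} {V} {U′ ⊗ V′} (bilinear {U} {V} {U′ ⊗ V′} (λ u v → f $ u ⊗ₑ g $ v)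
  (λ p q → relation (cong-⊗ (Lin.⟦⟧-cong f p) (Lin.⟦⟧-cong g q)))
  (λ u u′ v → ≋-trans (relation (cong-⊗ (Lin.+ᴹ-homo f u u′) V′.≈ᴹ-refl)) (relation (+-⊗ _ _ _)))
  (λ r u v → ≋-trans (relation (cong-⊗ (Lin.*ₗ-homo f r u) V′.≈ᴹ-refl)) (relation (*-⊗ _ _ _)))
  (λ u v v′ → ≋-trans (relation (cong-⊗ U′.≈ᴹ-refl (Lin.+ᴹ-homo g v v′))) (relation (⊗-+ _ _ _)))
  (λ u r v → ≋-trans (relation (cong-⊗ U′.≈ᴹ-refl (Lin.*ₗ-homo g r v))) (relation (⊗-* _ _ _))))
  where
  open Presented (Bilinearity U′ V′)
  module U′ = Module U′
  module V′ = Module V′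

module _ {U V W : ℚ-Space} where
  private module W = Module W

  ⊗-ext : (f g : U ⊗ V ⊸ W) → (∀ u v → f $ (u ⊗ₑ v) W.≈ᴹ g $ (u ⊗ₑ v)) → ∀ t → f $ t W.≈ᴹ g $ t
  ⊗-ext f g p (gen (u , v)) = p u v
  ⊗-ext f g p 𝟘       = W.≈ᴹ-trans (Lin.0ᴹ-homo f) (W.≈ᴹ-sym (Lin.0ᴹ-homo g))
  ⊗-ext f g p (x ⊞ y) = W.≈ᴹ-trans (Lin.+ᴹ-homo f x y) (W.≈ᴹ-trans
    (W.+ᴹ-cong (⊗-ext f g p x) (⊗-ext f g p y)) (W.≈ᴹ-sym (Lin.+ᴹ-homo g x y)))
  ⊗-ext f g p (r ⊡ x) = W.≈ᴹ-trans (Lin.*ₗ-homo f r x) (W.≈ᴹ-trans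
    (W.*ₗ-congˡ (⊗-ext f g p x)) (W.≈ᴹ-sym (Lin.*ₗ-homo g r x)))

-- (a ⊗ b) · (c ⊗ d) = (a · c) ⊗ (b · d)
⊗-mul : {V : ℚ-Space} → Bilinear V V V → Bilinear (V ⊗ V) (V ⊗ V) (V ⊗ V)
⊗-mul {V} μ = uncurry⊗ {V} {V} {Hom (V ⊗ V) (V ⊗ V)} (bilinear {V} {V} {Hom (V ⊗ V) (V ⊗ V)} right
  (λ {a} {a′} {b} {b′} p q → ⊗-ext {V} {V} {V ⊗ V} (right a b) (right a′ b′)
    (λ c d → relation (cong-⊗ (Lin.⟦⟧-cong μ p c) (Lin.⟦⟧-cong μ q d))))
  (λ a a′ b → ⊗-ext {V} {V} {V ⊗ V} (right (a V.+ᴹ a′) b) (right a b H.+ᴹ right a′ b)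
    (λ c d → ≋-trans (relation (cong-⊗ (Lin.+ᴹ-homo μ a a′ c) V.≈ᴹ-refl)) (relation (+-⊗ _ _ _))))
  (λ r a b → ⊗-ext {V} {V} {V ⊗ V} (right (r V.*ₗ a) b) (r H.*ₗ right a b)
    (λ c d → ≋-trans (relation (cong-⊗ (Lin.*ₗ-homo μ r a c) V.≈ᴹ-refl)) (relation (*-⊗ _ _ _))))
  (λ a b b′ → ⊗-ext {V} {V} {V ⊗ V} (right a (b V.+ᴹ b′)) (right a b H.+ᴹ right a b′)
    (λ c d → ≋-trans (relation (cong-⊗ V.≈ᴹ-refl (Lin.+ᴹ-homo μ b b′ d))) (relation (⊗-+ _ _ _))))
  (λ a r b → ⊗-ext {V} {V} {V ⊗ V} (right a (r V.*ₗ b)) (r H.*ₗ right a b)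
    (λ c d → ≋-trans (relation (cong-⊗ V.≈ᴹ-refl (Lin.*ₗ-homo μ r b d))) (relation (⊗-* _ _ _)))))
  where
  open Presented (Bilinearity V V)
  module V = Module V
  module H = Module (Hom (V ⊗ V) (V ⊗ V))
  right : ∥ V ∥ → ∥ V ∥ → V ⊗ V ⊸ V ⊗ V
  right a b = tensor {V} {V} {V} {V} (μ $ a) (μ $ b)

module _ (V : ℚ-Space) {I : Set} (g : I → ∥ V ∥) where
  private module V = Module V

  data Span : ∥ V ∥ → Set where
    gen     : ∀ i → Span (g i)
    zero    : Span V.0ᴹ
    add     : ∀ {x y} → Span x → Span y → Span (x V.+ᴹ y)
    scale   : ∀ r {x} → Span x → Span (r V.*ₗ x)
    respect : ∀ {x y} → x V.≈ᴹ y → Span x → Span y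

  span : ℚ-Space
  span = SpaceAxioms.space {A = ∃ Span}
    {_≈_ = λ x y → proj₁ x V.≈ᴹ proj₁ y}
    {_⊞_ = λ x y → proj₁ x V.+ᴹ proj₁ y , add (proj₂ x) (proj₂ y)}
    {𝟘 = V.0ᴹ , zero}
    {_⊡_ = λ r x → r V.*ₗ proj₁ x , scale r (proj₂ x)}
    (record
      { ≈-refl = V.≈ᴹ-refl ; ≈-sym = V.≈ᴹ-sym ; ≈-trans = V.≈ᴹ-trans
      ; ⊞-cong = V.+ᴹ-cong ; ⊡-cong = λ r → V.*ₗ-congˡ
      ; ⊞-assoc = λ x y z → V.+ᴹ-assoc _ _ _ ; ⊞-comm = λ x y → V.+ᴹ-comm _ _
      ; ⊞-identityˡ = λ x → V.+ᴹ-identityˡ _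
      ; ⊡-distribˡ = λ r x y → V.*ₗ-distribˡ r _ _
      ; ⊡-distribʳ = λ r s x → V.*ₗ-distribʳ _ r s
      ; ⊡-assoc = λ r s x → V.*ₗ-assoc r s _
      ; ⊡-identity = λ x → V.*ₗ-identityˡ _
      ; ⊡-zero = λ x → V.*ₗ-zeroˡ _ })

  inclusion : span ⊸ V
  inclusion = linear proj₁ id (λ _ _ → V.≈ᴹ-refl) (λ _ _ → V.≈ᴹ-refl)

module _ {V W : ℚ-Space} {I : Set} {g : I → ∥ V ∥} where
  private
    module V = Module V
    module W = Module W

  linear-span : (f h : V ⊸ W) → (∀ i → f $ g i W.≈ᴹ h $ g i) → ∀ {x} → Span V g x → f $ x W.≈ᴹ h $ x
  linear-span f h p (gen i) = p i
  linear-span f h p zero = W.≈ᴹ-trans (Lin.0ᴹ-homo f) (W.≈ᴹ-sym (Lin.0ᴹ-homo h))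
  linear-span f h p (add x y) = W.≈ᴹ-trans (Lin.+ᴹ-homo f _ _) (W.≈ᴹ-trans
    (W.+ᴹ-cong (linear-span f h p x) (linear-span f h p y)) (W.≈ᴹ-sym (Lin.+ᴹ-homo h _ _)))
  linear-span f h p (scale r x) = W.≈ᴹ-trans (Lin.*ₗ-homo f r _) (W.≈ᴹ-trans
    (W.*ₗ-congˡ (linear-span f h p x)) (W.≈ᴹ-sym (Lin.*ₗ-homo h r _)))
  linear-span f h p (respect e x) = W.≈ᴹ-trans (W.≈ᴹ-sym (Lin.⟦⟧-cong f e)) (W.≈ᴹ-trans
    (linear-span f h p x) (Lin.⟦⟧-cong h e))

module Sum (V : ℚ-Space) where
  open Module V
  open SpaceLemmas V

  ∑ : {I : Set} → List I → (I → ∥ V ∥) → ∥ V ∥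
  ∑ []       F = 0ᴹ
  ∑ (i ∷ is) F = F i +ᴹ ∑ is F

  ∑-cong : {I : Set} (is : List I) {F F′ : I → ∥ V ∥} → (∀ i → F i ≈ᴹ F′ i) → ∑ is F ≈ᴹ ∑ is F′
  ∑-cong []       p = ≈ᴹ-refl
  ∑-cong (i ∷ is) p = +ᴹ-cong (p i) (∑-cong is p)

  ∑-zero : {I : Set} (is : List I) {F : I → ∥ V ∥} → (∀ i → i ∈ is → F i ≈ᴹ 0ᴹ) → ∑ is F ≈ᴹ 0ᴹ
  ∑-zero []       p = ≈ᴹ-refl
  ∑-zero (i ∷ is) p =
    ≈ᴹ-trans (+ᴹ-cong (p i (here refl)) (∑-zero is (λ j → p j ∘ there))) (+ᴹ-identityˡ 0ᴹ)

  ∑-+ : {I : Set} (is : List I) (F F′ : I → ∥ V ∥) → ∑ is (λ i → F i +ᴹ F′ i) ≈ᴹ (∑ is F +ᴹ ∑ is F′)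
  ∑-+ []       F F′ = ≈ᴹ-sym (+ᴹ-identityˡ 0ᴹ)
  ∑-+ (i ∷ is) F F′ = ≈ᴹ-trans (+ᴹ-congˡ (∑-+ is F F′)) (interchange _ _ _ _)

  ∑-* : {I : Set} (is : List I) (r : ℚ) (F : I → ∥ V ∥) → ∑ is (λ i → r *ₗ F i) ≈ᴹ (r *ₗ ∑ is F)
  ∑-* []       r F = ≈ᴹ-sym (*ₗ-zeroʳ r)
  ∑-* (i ∷ is) r F = ≈ᴹ-trans (+ᴹ-congˡ (∑-* is r F)) (≈ᴹ-sym (*ₗ-distribˡ r _ _))

  ∑-++ : {I : Set} (is js : List I) (F : I → ∥ V ∥) → ∑ (is ++ js) F ≈ᴹ (∑ is F +ᴹ ∑ js F)
  ∑-++ []       js F = ≈ᴹ-sym (+ᴹ-identityˡ _)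
  ∑-++ (i ∷ is) js F = ≈ᴹ-trans (+ᴹ-congˡ (∑-++ is js F)) (≈ᴹ-sym (+ᴹ-assoc _ _ _))

  ∑-swap : {I J : Set} (is : List I) (js : List J) (F : I → J → ∥ V ∥) →
           ∑ is (λ i → ∑ js (F i)) ≈ᴹ ∑ js (λ j → ∑ is (λ i → F i j))
  ∑-swap []       js F = ≈ᴹ-sym (∑-zero js (λ _ _ → ≈ᴹ-refl))
  ∑-swap (i ∷ is) js F = ≈ᴹ-trans (+ᴹ-congˡ (∑-swap is js F)) (≈ᴹ-sym (∑-+ js (F i) _))

  ∑-map : {I J : Set} (f : J → I) (js : List J) (F : I → ∥ V ∥) → ∑ (map f js) F ≡ ∑ js (F ∘ f)
  ∑-map f []       F = refl
  ∑-map f (j ∷ js) F = cong (F (f j) +ᴹ_) (∑-map f js F)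

  ∑-at : {I : Set} {is : List I} {F : I → ∥ V ∥} {k : I} → Unique is → k ∈ is →
         (∀ i → i ≢ k → F i ≈ᴹ 0ᴹ) → ∑ is F ≈ᴹ F k
  ∑-at {is = i ∷ is} (i∉ ∷ _) (here refl) off =
    ≈ᴹ-trans (+ᴹ-congˡ (∑-zero is (λ j j∈ → off j (All.lookup i∉ j∈ ∘ sym)))) (+ᴹ-identityʳ _)
  ∑-at {is = i ∷ is} (i∉ ∷ u) (there k∈) off =
    ≈ᴹ-trans (+ᴹ-cong (off i (All.lookup i∉ k∈)) (∑-at u k∈ off)) (+ᴹ-identityˡ _)

  module _ {I : Set} (_≟_ : DecidableEquality I) where
    open DecMembership _≟_ using (_∈?_)

    ∑-at′ : {is : List I} {F : I → ∥ V ∥} (k : I) → Unique is →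
            (∀ i → i ≢ k → F i ≈ᴹ 0ᴹ) → (k ∉ is → F k ≈ᴹ 0ᴹ) → ∑ is F ≈ᴹ F k
    ∑-at′ {is = is} k u off out with k ∈? is
    ... | yes k∈ = ∑-at u k∈ off
    ... | no  k∉ = ≈ᴹ-trans (∑-zero is (λ i i∈ → off i (λ { refl → k∉ i∈ }))) (≈ᴹ-sym (out k∉))

    private
      only : (i : I) {j : I} → Dec (i ≡ j) → ∥ V ∥ → ∥ V ∥
      only i (yes _) v = v
      only i (no  _) v = 0ᴹ

      only-refl : ∀ i v → only i (i ≟ i) v ≈ᴹ v
      only-refl i v with i ≟ i
      ... | yes _ = ≈ᴹ-refl
      ... | no ¬p = contradiction refl ¬p

      only-off : ∀ i {j} v → i ≢ j → only i (i ≟ j) v ≈ᴹ 0ᴹ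
      only-off i {j} v ne with i ≟ j
      ... | yes p = contradiction p ne
      ... | no  _ = ≈ᴹ-refl

    -- Two duplicate-free lists carrying the support of F give the same sum.
    ∑-support : {is js : List I} {F : I → ∥ V ∥} → Unique is → Unique js →
                (∀ i → i ∉ is → F i ≈ᴹ 0ᴹ) → (∀ i → i ∉ js → F i ≈ᴹ 0ᴹ) → ∑ is F ≈ᴹ ∑ js F
    ∑-support {is} {js} {F} u v p q = begin
      ∑ is F                                          ≈⟨ ∑-cong is (λ i → ≈ᴹ-sym (row i)) ⟩
      ∑ is (λ i → ∑ js (λ j → only i (i ≟ j) (F j)))  ≈⟨ ∑-swap is js _ ⟩
      ∑ js (λ j → ∑ is (λ i → only i (i ≟ j) (F j)))  ≈⟨ ∑-cong js column ⟩
      ∑ js F                                          ∎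
      where
      open SetoidReasoning ≈ᴹ-setoid
      row : ∀ i → ∑ js (λ j → only i (i ≟ j) (F j)) ≈ᴹ F i
      row i = ≈ᴹ-trans
        (∑-at′ i v (λ j ne → only-off i (F j) (ne ∘ sym))
          (λ i∉ → ≈ᴹ-trans (only-refl i (F i)) (q i i∉)))
        (only-refl i (F i))
      column : ∀ j → ∑ is (λ i → only i (i ≟ j) (F j)) ≈ᴹ F j
      column j = ≈ᴹ-trans
        (∑-at′ j u (λ i ne → only-off i (F j) ne)
          (λ j∉ → ≈ᴹ-trans (only-refl j (F j)) (p j j∉)))
        (only-refl j (F j))

module _ {V W : ℚ-Space} where
  private
    module V = Module V
    module W = Module W

  linear-∑ : (f : V ⊸ W) {I : Set} (is : List I) (F : I → ∥ V ∥) →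
             f $ Sum.∑ V is F W.≈ᴹ Sum.∑ W is (λ i → f $ F i)
  linear-∑ f []       F = Lin.0ᴹ-homo f
  linear-∑ f (i ∷ is) F = W.≈ᴹ-trans (Lin.+ᴹ-homo f _ _) (W.+ᴹ-congˡ (linear-∑ f is F))

ℕ² : Set
ℕ² = ℕ × ℕ

0² : ℕ²
0² = 0 , 0

infixl 6 _+²_
_+²_ : ℕ² → ℕ² → ℕ²
(a , b) +² (a′ , b′) = a ℕ.+ a′ , b ℕ.+ b′

_≟²_ : DecidableEquality ℕ²
_≟²_ = Product.≡-dec ℕₚ._≟_ ℕₚ._≟_

total : ℕ² → ℕ
total (a , b) = a ℕ.+ b

ℕ²₊ : Set
ℕ²₊ = [ α ∈ ℕ² ∣ α ≢ 0² ]

Bicomposition : Set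
Bicomposition = List ℕ²₊

sum² : List ℕ² → ℕ²
sum² = foldr _+²_ 0²

exponents : Bicomposition → List ℕ²
exponents = map value

bidegree : Bicomposition → ℕ²
bidegree a = sum² (exponents a)

_≟ᵇ_ : DecidableEquality Bicomposition
_≟ᵇ_ = List.≡-dec (Refinement._≟_ _≟²_)

splitsℕ : ℕ → List (ℕ × ℕ)
splitsℕ n = map (λ i → i , n ∸ i) (upTo (suc n))

-- all (β , γ) with β + γ = α
splits : ℕ² → List (ℕ² × ℕ²)
splits (a , b) =
  cartesianProductWith (λ (i , i′) (j , j′) → (i , j) , (i′ , j′)) (splitsℕ a) (splitsℕ b)

infixr 5 _∷₂_
_∷₂_ : {A B : Set} → A × B → List A × List B → List A × List B
(x , y) ∷₂ (xs , ys) = x ∷ xs , y ∷ ys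

-- all (e′ , e″) with e′ + e″ = e entrywise
splitsᴸ : List ℕ² → List (List ℕ² × List ℕ²)
splitsᴸ []      = ([] , []) ∷ []
splitsᴸ (α ∷ e) =
  cartesianProductWith _∷₂_ (splits α) (splitsᴸ e)

deconcatenations : {A : Set} → List A → List (List A × List A)
deconcatenations []       = ([] , []) ∷ []
deconcatenations (x ∷ xs) =
  ([] , x ∷ xs) ∷ map (λ (ys , zs) → x ∷ ys , zs) (deconcatenations xs)

⟦_⟧ : {P : Set} → Dec P → ℚ
⟦ d ⟧ = if does d then 1ℚ else 0ℚ

⟦⟧-yes : {P : Set} (d : Dec P) → P → ⟦ d ⟧ ≡ 1ℚ
⟦⟧-yes (yes _) p = refl
⟦⟧-yes (no ¬p) p = contradiction p ¬p

⟦⟧-no : {P : Set} (d : Dec P) → ¬ P → ⟦ d ⟧ ≡ 0ℚ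
⟦⟧-no (yes p) ¬p = contradiction p ¬p
⟦⟧-no (no _)  ¬p = refl

⟦⟧-⇔ : {P Q : Set} (d : Dec P) (d′ : Dec Q) → (P → Q) → (Q → P) → ⟦ d ⟧ ≡ ⟦ d′ ⟧
⟦⟧-⇔ (yes p) d′ f g = sym (⟦⟧-yes d′ (f p))
⟦⟧-⇔ (no ¬p) d′ f g = sym (⟦⟧-no d′ (¬p ∘ g))

open Sum 𝕜 using (∑; ∑-cong; ∑-zero; ∑-+; ∑-*; ∑-++; ∑-map)
open ≡-Reasoning

∑-product : {I J K : Set} (f : I → J → K) (is : List I) (js : List J) (F : K → ℚ) →
            ∑ (cartesianProductWith f is js) F ≡ ∑ is (λ i → ∑ js (λ j → F (f i j)))
∑-product f []       js F = refl
∑-product f (i ∷ is) js F =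
  trans (∑-++ (map (f i) js) _ F) (cong₂ _+_ (∑-map (f i) js F) (∑-product f is js F))

-- A formal series in x₁, x₂, …, y₁, y₂, …: the monomial
-- ∏ᵢ xᵢ^(aᵢ) yᵢ^(bᵢ) is given by the list of its exponents (aᵢ , bᵢ), where
-- trailing zeros are immaterial.
record Series : Set where
  field
    coeff : List ℕ² → ℚ
    pad   : ∀ e → coeff (e ++ 0² ∷ []) ≡ coeff e
open Series

SeriesSpace : ℚ-Space
SeriesSpace = SpaceAxioms.space {A = Series}
  {_≈_ = λ s t → ∀ e → coeff s e ≡ coeff t e}
  {_⊞_ = λ s t → record
    { coeff = λ e → coeff s e + coeff t e ; pad = λ e → cong₂ _+_ (pad s e) (pad t e) }}
  {𝟘 = record { coeff = λ _ → 0ℚ ; pad = λ _ → refl }}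
  {_⊡_ = λ r s → record { coeff = λ e → r * coeff s e ; pad = λ e → cong (r *_) (pad s e) }}
  (record
    { ≈-refl      = λ _ → refl
    ; ≈-sym       = λ p e → sym (p e)
    ; ≈-trans     = λ p q e → trans (p e) (q e)
    ; ⊞-cong      = λ p q e → cong₂ _+_ (p e) (q e)
    ; ⊡-cong      = λ r p e → cong (r *_) (p e)
    ; ⊞-assoc     = λ s t u e → ℚₚ.+-assoc (coeff s e) (coeff t e) (coeff u e)
    ; ⊞-comm      = λ s t e → ℚₚ.+-comm (coeff s e) (coeff t e)
    ; ⊞-identityˡ = λ s e → ℚₚ.+-identityˡ (coeff s e)
    ; ⊡-distribˡ  = λ r s t e → ℚₚ.*-distribˡ-+ r (coeff s e) (coeff t e)
    ; ⊡-distribʳ  = λ r r′ s e → ℚₚ.*-distribʳ-+ (coeff s e) r r′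
    ; ⊡-assoc     = λ r r′ s e → ℚₚ.*-assoc r r′ (coeff s e)
    ; ⊡-identity  = λ s e → ℚₚ.*-identityˡ (coeff s e)
    ; ⊡-zero      = λ s e → ℚₚ.*-zeroˡ (coeff s e)
    })

coefficient : List ℕ² → SeriesSpace ⊸ 𝕜
coefficient e = linear (λ s → coeff s e) (λ p → p e) (λ _ _ → refl) (λ _ _ → refl)

-- The exponent lists of the monomials x_{i₁}^{a₁} y_{i₁}^{b₁} ⋯ x_{iₖ}^{aₖ} y_{iₖ}^{bₖ}
-- with i₁ < ⋯ < iₖ ≤ n; the two summands are i₁ = 1 and i₁ > 1.
placements : Bicomposition → ℕ → List (List ℕ²)
placements []      zero    = [] ∷ []
placements []      (suc n) = map (0² ∷_) (placements [] n)
placements (α ∷ a) zero    = []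
placements (α ∷ a) (suc n) =
  map (value α ∷_) (placements a n) ++ map (0² ∷_) (placements (α ∷ a) n)

_≟ᴸ_ : DecidableEquality (List ℕ²)
_≟ᴸ_ = List.≡-dec _≟²_

-- A monomial whose exponents are zero beyond position n only arises from iₖ ≤ n,
-- since the vectors in a are nonzero.
coeffM : Bicomposition → List ℕ² → ℚ
coeffM a e = ∑ (placements a (length e)) (λ e′ → ⟦ e ≟ᴸ e′ ⟧)

-- deletes the zero vectors
pack : List ℕ² → Bicomposition
pack []      = []
pack (ε ∷ e) with ε ≟² 0²
... | yes _ = pack e
... | no ¬p = (ε , [ ¬p ]) ∷ pack e

pack-++ : ∀ e e′ → pack (e ++ e′) ≡ pack e ++ pack e′
pack-++ []      e′ = refl
pack-++ (ε ∷ e) e′ with ε ≟² 0²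
... | yes _ = pack-++ e e′
... | no ¬p = cong (_ ∷_) (pack-++ e e′)

pack-exponents : ∀ a → pack (exponents a) ≡ a
pack-exponents []      = refl
pack-exponents ((α , [ nz ]) ∷ a) with α ≟² 0²
... | yes p = ⊥-elim-irr (nz p)
... | no _  = cong (_ ∷_) (pack-exponents a)

sum²-pack : ∀ e → bidegree (pack e) ≡ sum² e
sum²-pack []      = refl
sum²-pack (ε ∷ e) with ε ≟² 0²
... | yes refl = sum²-pack e
... | no _     = cong (ε +²_) (sum²-pack e)

∑-∷-same : ∀ x e (ps : List (List ℕ²)) →
           ∑ (map (x ∷_) ps) (λ e′ → ⟦ (x ∷ e) ≟ᴸ e′ ⟧) ≡ ∑ ps (λ e′ → ⟦ e ≟ᴸ e′ ⟧)
∑-∷-same x e ps = trans (∑-map (x ∷_) ps _) (∑-cong ps (λ e′ →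
  ⟦⟧-⇔ ((x ∷ e) ≟ᴸ (x ∷ e′)) (e ≟ᴸ e′) List.∷-injectiveʳ (cong (x ∷_))))

∑-∷-diff : ∀ {x y} e (ps : List (List ℕ²)) → x ≢ y →
           ∑ (map (y ∷_) ps) (λ e′ → ⟦ (x ∷ e) ≟ᴸ e′ ⟧) ≡ 0ℚ
∑-∷-diff {x} {y} e ps x≢y = trans (∑-map (y ∷_) ps _) (∑-zero ps (λ e′ _ →
  ⟦⟧-no ((x ∷ e) ≟ᴸ (y ∷ e′)) (x≢y ∘ List.∷-injectiveˡ)))

nonzero : (α : ℕ²₊) → value α ≢ 0²
nonzero (α , [ nz ]) p = ⊥-elim-irr (nz p)

coeffM-pack : ∀ a e → coeffM a e ≡ ⟦ pack e ≟ᵇ a ⟧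
coeffM-pack []      [] = ℚₚ.+-identityʳ 1ℚ
coeffM-pack (α ∷ a) [] = refl
coeffM-pack []      (ε ∷ e) with ε ≟² 0²
... | yes refl = trans (∑-∷-same 0² e (placements [] (length e))) (coeffM-pack [] e)
... | no ε≢0   = ∑-∷-diff e (placements [] (length e)) ε≢0
coeffM-pack (α ∷ a) (ε ∷ e) with ε ≟² 0²
... | yes refl = begin
  _                            ≡⟨ ∑-++ (map (value α ∷_) (placements a (length e))) _ _ ⟩
  _                            ≡⟨ cong₂ _+_ (∑-∷-diff e (placements a (length e)) (nonzero α ∘ sym))
                                            (∑-∷-same 0² e (placements (α ∷ a) (length e))) ⟩
  0ℚ + coeffM (α ∷ a) e        ≡⟨ ℚₚ.+-identityˡ _ ⟩
  coeffM (α ∷ a) e             ≡⟨ coeffM-pack (α ∷ a) e ⟩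
  ⟦ pack e ≟ᵇ (α ∷ a) ⟧        ∎
... | no ε≢0 = begin
  _     ≡⟨ ∑-++ (map (value α ∷_) (placements a (length e))) _ _ ⟩
  _     ≡⟨ cong (∑ (map (value α ∷_) (placements a (length e))) (λ e′ → ⟦ (ε ∷ e) ≟ᴸ e′ ⟧) +_) (∑-∷-diff e (placements (α ∷ a) (length e)) ε≢0) ⟩
  _     ≡⟨ ℚₚ.+-identityʳ _ ⟩
  _     ≡⟨ first (ε ≟² value α) ⟩
  ⟦ ((ε , [ ε≢0 ]) ∷ pack e) ≟ᵇ (α ∷ a) ⟧ ∎
  where
  first : Dec (ε ≡ value α) →
          ∑ (map (value α ∷_) (placements a (length e))) (λ e′ → ⟦ (ε ∷ e) ≟ᴸ e′ ⟧)
          ≡ ⟦ ((ε , [ ε≢0 ]) ∷ pack e) ≟ᵇ (α ∷ a) ⟧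
  first (yes refl) = trans (∑-∷-same ε e (placements a (length e))) (trans (coeffM-pack a e)
    (⟦⟧-⇔ (pack e ≟ᵇ a) (((ε , [ ε≢0 ]) ∷ pack e) ≟ᵇ (α ∷ a)) (cong (_ ∷_)) List.∷-injectiveʳ))
  first (no ε≢α) = trans (∑-∷-diff e (placements a (length e)) ε≢α)
    (sym (⟦⟧-no (((ε , [ ε≢0 ]) ∷ pack e) ≟ᵇ (α ∷ a)) (ε≢α ∘ cong value ∘ List.∷-injectiveˡ)))

M : Bicomposition → Series
M a = record { coeff = coeffM a ; pad = λ e → begin
  coeffM a (e ++ 0² ∷ [])       ≡⟨ coeffM-pack a (e ++ 0² ∷ []) ⟩
  ⟦ pack (e ++ 0² ∷ []) ≟ᵇ a ⟧  ≡⟨ cong (λ b → ⟦ b ≟ᵇ a ⟧) (trans (pack-++ e (0² ∷ [])) (List.++-identityʳ (pack e))) ⟩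
  ⟦ pack e ≟ᵇ a ⟧               ≡⟨ sym (coeffM-pack a e) ⟩
  coeffM a e                    ∎ }

splits-pad : ∀ e (F : List ℕ² × List ℕ² → ℚ) →
             ∑ (splitsᴸ (e ++ 0² ∷ [])) F
             ≡ ∑ (splitsᴸ e) (λ (p , q) → F (p ++ 0² ∷ [] , q ++ 0² ∷ []))
splits-pad []      F = refl
splits-pad (α ∷ e) F = begin
  _ ≡⟨ ∑-product _∷₂_ (splits α) (splitsᴸ (e ++ 0² ∷ [])) F ⟩
  _ ≡⟨ ∑-cong (splits α) (λ (β , γ) → splits-pad e (λ (p , q) → F (β ∷ p , γ ∷ q))) ⟩
  _ ≡⟨ sym (∑-product _∷₂_ (splits α) (splitsᴸ e) _) ⟩
  _ ∎

infixl 7 _⋆_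
_⋆_ : Series → Series → Series
s ⋆ t = record
  { coeff = λ e → ∑ (splitsᴸ e) (λ (e′ , e″) → coeff s e′ * coeff t e″)
  ; pad   = λ e → trans (splits-pad e _)
                        (∑-cong (splitsᴸ e) (λ (p , q) → cong₂ _*_ (pad s p) (pad t q))) }

*-left : ∀ r x y → (r * x) * y ≡ r * (x * y)
*-left = ℚₚ.*-assoc

*-right : ∀ r x y → x * (r * y) ≡ r * (x * y)
*-right r x y = trans (sym (ℚₚ.*-assoc x r y)) (trans (cong (_* y) (ℚₚ.*-comm x r)) (ℚₚ.*-assoc r x y))

⋆-bilinear : Bilinear SeriesSpace SeriesSpace SeriesSpace
⋆-bilinear = bilinear {SeriesSpace} {SeriesSpace} {SeriesSpace} _⋆_
  (λ p q e → ∑-cong (splitsᴸ e) (λ (e′ , e″) → cong₂ _*_ (p e′) (q e″)))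
  (λ s s′ t e → trans
    (∑-cong (splitsᴸ e) (λ (e′ , e″) → ℚₚ.*-distribʳ-+ (coeff t e″) (coeff s e′) (coeff s′ e′)))
    (∑-+ (splitsᴸ e) _ _))
  (λ r s t e → trans
    (∑-cong (splitsᴸ e) (λ (e′ , e″) → *-left r (coeff s e′) (coeff t e″)))
    (∑-* (splitsᴸ e) r _))
  (λ s t t′ e → trans
    (∑-cong (splitsᴸ e) (λ (e′ , e″) → ℚₚ.*-distribˡ-+ (coeff s e′) (coeff t e″) (coeff t′ e″)))
    (∑-+ (splitsᴸ e) _ _))
  (λ s r t e → trans
    (∑-cong (splitsᴸ e) (λ (e′ , e″) → *-right r (coeff s e′) (coeff t e″)))
    (∑-* (splitsᴸ e) r _))

-- Inserting zeros into an exponent list does not affect sums over its splits.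
ZeroInvariant : (List ℕ² × List ℕ² → ℚ) → Set
ZeroInvariant F = ∀ p₁ p₂ q₁ q₂ → F (p₁ ++ 0² ∷ p₂ , q₁ ++ 0² ∷ q₂) ≡ F (p₁ ++ p₂ , q₁ ++ q₂)

splits-pack : ∀ e F → ZeroInvariant F → ∑ (splitsᴸ e) F ≡ ∑ (splitsᴸ (exponents (pack e))) F
splits-pack []      F inv = refl
splits-pack (ε ∷ e) F inv with ε ≟² 0²
... | yes refl = begin
  _ ≡⟨ ∑-product _∷₂_ (splits 0²) (splitsᴸ e) F ⟩
  _ ≡⟨ ℚₚ.+-identityʳ _ ⟩
  _ ≡⟨ ∑-cong (splitsᴸ e) (λ (p , q) → inv [] p [] q) ⟩
  _ ≡⟨ splits-pack e F inv ⟩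
  _ ∎
... | no _ = begin
  _ ≡⟨ ∑-product _∷₂_ (splits ε) (splitsᴸ e) F ⟩
  _ ≡⟨ ∑-cong (splits ε) (λ (β , γ) → splits-pack e (λ (p , q) → F (β ∷ p , γ ∷ q))
         (λ p₁ p₂ q₁ q₂ → inv (β ∷ p₁) p₂ (γ ∷ q₁) q₂)) ⟩
  _ ≡⟨ sym (∑-product _∷₂_ (splits ε) (splitsᴸ (exponents (pack e))) F) ⟩
  _ ∎

+²-interchange : ∀ α β γ δ → (α +² β) +² (γ +² δ) ≡ (α +² γ) +² (β +² δ)
+²-interchange (a , a′) (b , b′) (c , c′) (d , d′) = cong₂ _,_ (swap a b c d) (swap a′ b′ c′ d′)
  where
  open CommutativeSemigroupProperties ℕₚ.+-commutativeSemigroup using () renaming (interchange to swap)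

splitsℕ-sum : ∀ n {i j} → (i , j) ∈ splitsℕ n → i ℕ.+ j ≡ n
splitsℕ-sum n ij∈ with ∈-map⁻ (λ i → i , n ∸ i) ij∈
... | i , i∈ , refl = ℕₚ.m+[n∸m]≡n (ℕₚ.≤-pred (∈-upTo⁻ i∈))

splits-sum : ∀ α {β γ} → (β , γ) ∈ splits α → β +² γ ≡ α
splits-sum (a , b) p with ∈-cartesianProductWith⁻ _ (splitsℕ a) (splitsℕ b) p
... | _ , _ , p₁ , p₂ , refl = cong₂ _,_ (splitsℕ-sum a p₁) (splitsℕ-sum b p₂)

splitsᴸ-sum : ∀ e {p q} → (p , q) ∈ splitsᴸ e → sum² p +² sum² q ≡ sum² e
splitsᴸ-sum []      (here refl) = refl
splitsᴸ-sum (α ∷ e) m with ∈-cartesianProductWith⁻ _∷₂_ (splits α) (splitsᴸ e) m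
... | (β , γ) , (p , q) , m₁ , m₂ , refl =
  trans (+²-interchange β (sum² p) γ (sum² q)) (cong₂ _+²_ (splits-sum α m₁) (splitsᴸ-sum e m₂))

-- Duplicate-free finite lists of bicompositions containing every
-- bicomposition of bounded total degree.
rightwards : ℕ × ℕ → ℕ²₊
rightwards (i , j) = (suc i , j) , [ (λ ()) ]

upwards : ℕ → ℕ²₊
upwards j = (0 , suc j) , [ (λ ()) ]

vectors : ℕ → List ℕ²₊
vectors n = map rightwards (cartesianProduct (upTo n) (upTo (suc n))) ++ map upwards (upTo n)

words : ℕ → ℕ → List Bicomposition
words n zero    = [] ∷ []
words n (suc k) = [] ∷ cartesianProductWith _∷_ (vectors n) (words n k)

bicompositions : ℕ → List Bicomposition
bicompositions n = words n n

vectors-unique : ∀ n → Unique (vectors n)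
vectors-unique n = Unique.++⁺
  (Unique.map⁺ (λ { refl → refl }) (cartesianProduct⁺ (upTo⁺ n) (upTo⁺ (suc n))))
  (Unique.map⁺ (λ { refl → refl }) (upTo⁺ n))
  (λ (m₁ , m₂) → disjoint (∈-map⁻ rightwards m₁) (∈-map⁻ upwards m₂))
  where
  disjoint : ∀ {v : ℕ²₊} →
    ∃ (λ x → x ∈ cartesianProduct (upTo n) (upTo (suc n)) × v ≡ rightwards x) →
    ∃ (λ j → j ∈ upTo n × v ≡ upwards j) → ⊥
  disjoint (_ , _ , refl) (_ , _ , ())

words-unique : ∀ n k → Unique (words n k)
words-unique n zero    = [] ∷ []
words-unique n (suc k) =
  All.tabulate (λ m p → nonempty (subst (_∈ _) (sym p) m))
  ∷ cartesianProductWith⁺ _∷_ (λ { refl → refl , refl }) (vectors-unique n) (words-unique n k)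
  where
  nonempty : [] ∈ cartesianProductWith _∷_ (vectors n) (words n k) → ⊥
  nonempty m with ∈-cartesianProductWith⁻ _∷_ (vectors n) (words n k) m
  ... | _ , _ , _ , _ , ()

∈-vectors : ∀ n (α : ℕ²₊) → total (value α) ≤ n → α ∈ vectors n
∈-vectors n ((zero  , zero)  , [ nz ]) le = ⊥-elim-irr (nz refl)
∈-vectors n ((zero  , suc j) , _) le =
  ∈-++⁺ʳ _ (∈-map⁺ upwards (∈-upTo⁺ le))
∈-vectors n ((suc i , j) , _) le =
  ∈-++⁺ˡ (∈-map⁺ rightwards (∈-cartesianProduct⁺
    (∈-upTo⁺ (ℕₚ.≤-trans (s≤s (ℕₚ.m≤m+n i j)) le))
    (∈-upTo⁺ (s≤s (ℕₚ.≤-trans (ℕₚ.m≤n+m j (suc i)) le)))))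

total-+² : ∀ α β → total (α +² β) ≡ total α ℕ.+ total β
total-+² (a , b) (c , d) = interchange a c b d
  where open CommutativeSemigroupProperties ℕₚ.+-commutativeSemigroup using (interchange)

total-positive : (α : ℕ²₊) → 1 ≤ total (value α)
total-positive ((zero  , zero)  , [ nz ]) = ⊥-elim-irr (nz refl)
total-positive ((zero  , suc j) , _) = s≤s z≤n
total-positive ((suc i , j)     , _) = s≤s z≤n

∈-words : ∀ n k a → total (bidegree a) ≤ k → k ≤ n → a ∈ words n k
∈-words n zero    []      le k≤n = here refl
∈-words n (suc k) []      le k≤n = here refl
∈-words n zero    (α ∷ a) le k≤n = contradiction
  (ℕₚ.≤-trans (total-positive α)
    (ℕₚ.m+n≤o⇒m≤o _ (subst (_≤ 0) (total-+² (value α) (bidegree a)) le))) λ ()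
∈-words n (suc k) (α ∷ a) le k≤n = there (∈-cartesianProductWith⁺ _∷_
  (∈-vectors n α (ℕₚ.≤-trans (ℕₚ.m+n≤o⇒m≤o _ le′) k≤n))
  (∈-words n k a (ℕₚ.≤-pred (ℕₚ.≤-trans (ℕₚ.+-monoˡ-≤ _ (total-positive α)) le′))
    (ℕₚ.≤-trans (ℕₚ.n≤1+n k) k≤n)))
  where
  le′ : total (value α) ℕ.+ total (bidegree a) ≤ suc k
  le′ = subst (_≤ suc k) (total-+² (value α) (bidegree a)) le

∈-bicompositions : ∀ n a → total (bidegree a) ≤ n → a ∈ bicompositions n
∈-bicompositions n a le = ∈-words n n a le ℕₚ.≤-refl

Fibre : ℕ² → Set
Fibre d = ∃ λ a → bidegree a ≡ d

coeffM-zero : ∀ a p₁ p₂ → coeffM a (p₁ ++ 0² ∷ p₂) ≡ coeffM a (p₁ ++ p₂)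
coeffM-zero a p₁ p₂ = begin
  coeffM a (p₁ ++ 0² ∷ p₂)        ≡⟨ coeffM-pack a (p₁ ++ 0² ∷ p₂) ⟩
  ⟦ pack (p₁ ++ 0² ∷ p₂) ≟ᵇ a ⟧   ≡⟨ cong (λ b → ⟦ b ≟ᵇ a ⟧) (trans (pack-++ p₁ (0² ∷ p₂)) (sym (pack-++ p₁ p₂))) ⟩
  ⟦ pack (p₁ ++ p₂) ≟ᵇ a ⟧        ≡⟨ sym (coeffM-pack a (p₁ ++ p₂)) ⟩
  coeffM a (p₁ ++ p₂)             ∎

coeffM-degree : ∀ a e → sum² e ≢ bidegree a → coeffM a e ≡ 0ℚ
coeffM-degree a e ne = trans (coeffM-pack a e)
  (⟦⟧-no (pack e ≟ᵇ a) (λ p → ne (trans (sym (sum²-pack e)) (cong bidegree p))))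

coeffM-exponents : ∀ a b → coeffM a (exponents b) ≡ ⟦ b ≟ᵇ a ⟧
coeffM-exponents a b =
  trans (coeffM-pack a (exponents b)) (cong (λ c → ⟦ c ≟ᵇ a ⟧) (pack-exponents b))

-- A homogeneous series whose coefficients ignore interspersed zeros is a
-- linear combination of the M a in its bidegree.
module Expansion (s : Series) (d : ℕ²)
                 (homogeneous : ∀ e → sum² e ≢ d → coeff s e ≡ 0ℚ)
                 (packed : ∀ e → coeff s e ≡ coeff s (exponents (pack e))) where

  private
    module S = Module SeriesSpace
    module SumS = Sum SeriesSpace

    E : List Bicomposition
    E = bicompositions (total d)

    term : Bicomposition → Series
    term c = coeff s (exponents c) S.*ₗ M c

    term∈ : ∀ c → Span SeriesSpace (λ (a : Fibre d) → M (proj₁ a)) (term c)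
    term∈ c = go (bidegree c ≟² d)
      where
      go : Dec (bidegree c ≡ d) → Span SeriesSpace (λ (a : Fibre d) → M (proj₁ a)) (term c)
      go (yes p) = scale (coeff s (exponents c)) {M c} (gen (c , p))
      go (no ¬p) = respect {x = S.0ᴹ} {y = term c}
        (λ e → sym (trans (cong (_* coeffM c e) (homogeneous (exponents c) ¬p)) (ℚₚ.*-zeroˡ (coeffM c e)))) zero

    sum∈ : ∀ cs → Span SeriesSpace (λ (a : Fibre d) → M (proj₁ a)) (SumS.∑ cs term)
    sum∈ []       = zero
    sum∈ (c ∷ cs) = add {x = term c} {y = SumS.∑ cs term} (term∈ c) (sum∈ cs)

    expansion : SumS.∑ E term S.≈ᴹ s
    expansion e = begin
      coeff (SumS.∑ E term) e                         ≡⟨ linear-∑ (coefficient e) E term ⟩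
      ∑ E (λ c → coeff s (exponents c) * coeffM c e)  ≡⟨ Sum.∑-at′ 𝕜 _≟ᵇ_ (pack e) (words-unique (total d) (total d)) off out ⟩
      coeff s (exponents (pack e)) * coeffM (pack e) e ≡⟨ cong₂ _*_ (sym (packed e))
                                                        (trans (coeffM-pack (pack e) e) (⟦⟧-yes (pack e ≟ᵇ pack e) refl)) ⟩
      coeff s e * 1ℚ                                  ≡⟨ ℚₚ.*-identityʳ (coeff s e) ⟩
      coeff s e                                       ∎
      where
      off : ∀ c → c ≢ pack e → coeff s (exponents c) * coeffM c e ≡ 0ℚ
      off c ne = trans (cong (coeff s (exponents c) *_)
        (trans (coeffM-pack c e) (⟦⟧-no (pack e ≟ᵇ c) (ne ∘ sym)))) (ℚₚ.*-zeroʳ (coeff s (exponents c)))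
      out : pack e ∉ E → coeff s (exponents (pack e)) * coeffM (pack e) e ≡ 0ℚ
      out ∉E = trans (cong (_* coeffM (pack e) e) (homogeneous (exponents (pack e))
        (λ p → ∉E (∈-bicompositions (total d) (pack e) (ℕₚ.≤-reflexive (cong total p))))))
        (ℚₚ.*-zeroˡ (coeffM (pack e) e))

  homogeneous-span : Span SeriesSpace (λ (a : Fibre d) → M (proj₁ a)) s
  homogeneous-span = respect expansion (sum∈ E)

M-⋆ : ∀ a b → Span SeriesSpace (λ (c : Fibre (bidegree a +² bidegree b)) → M (proj₁ c)) (M a ⋆ M b)
M-⋆ a b = Expansion.homogeneous-span (M a ⋆ M b) (bidegree a +² bidegree b)
  (λ e ne → ∑-zero (splitsᴸ e) (λ (p , q) pq∈ →
    vanish p q (λ r → ne (trans (sym (splitsᴸ-sum e pq∈)) r)) (sum² p ≟² bidegree a) (sum² q ≟² bidegree b)))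
  (λ e → splits-pack e (λ (p , q) → coeffM a p * coeffM b q)
    (λ p₁ p₂ q₁ q₂ → cong₂ _*_ (coeffM-zero a p₁ p₂) (coeffM-zero b q₁ q₂)))
  where
  vanish : ∀ p q → sum² p +² sum² q ≢ bidegree a +² bidegree b →
           Dec (sum² p ≡ bidegree a) → Dec (sum² q ≡ bidegree b) → coeffM a p * coeffM b q ≡ 0ℚ
  vanish p q ne (yes x) (yes y) = contradiction (cong₂ _+²_ x y) ne
  vanish p q ne (no ¬x) _ = trans (cong (_* coeffM b q) (coeffM-degree a p ¬x)) (ℚₚ.*-zeroˡ (coeffM b q))
  vanish p q ne _ (no ¬y) = trans (cong (coeffM a p *_) (coeffM-degree b q ¬y)) (ℚₚ.*-zeroʳ (coeffM a p))

DQSymSpace : ℚ-Space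
DQSymSpace = span SeriesSpace M

𝐌 : Bicomposition → ∥ DQSymSpace ∥
𝐌 a = M a , gen a

module SeriesM = Module SeriesSpace

forget : ∀ {d s} → Span SeriesSpace (λ (a : Fibre d) → M (proj₁ a)) s → Span SeriesSpace M s
forget (gen i)       = gen (proj₁ i)
forget zero          = zero
forget (add p q)     = add (forget p) (forget q)
forget (scale r p)   = scale r (forget p)
forget (respect e p) = respect e (forget p)

Span-⋆ : ∀ {s t} → Span SeriesSpace M s → Span SeriesSpace M t → Span SeriesSpace M (s ⋆ t)
Span-⋆ {s} p (add {x} {y} q q′)  =
  respect (SeriesM.≈ᴹ-sym {s ⋆ (x SeriesM.+ᴹ y)} {s ⋆ x SeriesM.+ᴹ s ⋆ y} (Lin.+ᴹ-homo (⋆-bilinear $ s) x y))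
          (add (Span-⋆ p q) (Span-⋆ p q′))
Span-⋆ {s} p (scale r {x} q)     =
  respect (SeriesM.≈ᴹ-sym {s ⋆ (r SeriesM.*ₗ x)} {r SeriesM.*ₗ (s ⋆ x)} (Lin.*ₗ-homo (⋆-bilinear $ s) r x))
          (scale r (Span-⋆ p q))
Span-⋆ {s} p (respect {x} {y} e q) = respect (Lin.⟦⟧-cong (⋆-bilinear $ s) {x} {y} e) (Span-⋆ p q)
Span-⋆ {s} p zero                =
  respect (SeriesM.≈ᴹ-sym {s ⋆ SeriesM.0ᴹ} {SeriesM.0ᴹ} (Lin.0ᴹ-homo (⋆-bilinear $ s))) zero
Span-⋆ {t = t} (add {x} {y} p p′) (gen b) =
  respect (SeriesM.≈ᴹ-sym {(x SeriesM.+ᴹ y) ⋆ t} {x ⋆ t SeriesM.+ᴹ y ⋆ t} (Lin.+ᴹ-homo ⋆-bilinear x y t))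
          (add (Span-⋆ p (gen b)) (Span-⋆ p′ (gen b)))
Span-⋆ {t = t} (scale r {x} p) (gen b) =
  respect (SeriesM.≈ᴹ-sym {(r SeriesM.*ₗ x) ⋆ t} {r SeriesM.*ₗ (x ⋆ t)} (Lin.*ₗ-homo ⋆-bilinear r x t))
          (scale r (Span-⋆ p (gen b)))
Span-⋆ {t = t} (respect {x} {y} e p) (gen b) =
  respect (Lin.⟦⟧-cong ⋆-bilinear {x} {y} e t) (Span-⋆ p (gen b))
Span-⋆ {t = t} zero (gen b) =
  respect (SeriesM.≈ᴹ-sym {SeriesM.0ᴹ ⋆ t} {SeriesM.0ᴹ} (Lin.0ᴹ-homo ⋆-bilinear t)) zero
Span-⋆ (gen a) (gen b) = forget (M-⋆ a b)

DQSym-mul : Bilinear DQSymSpace DQSymSpace DQSymSpace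
DQSym-mul = bilinear {DQSymSpace} {DQSymSpace} {DQSymSpace}
  (λ (s , p) (t , q) → s ⋆ t , Span-⋆ p q)
  (λ {x} {x′} {y} {y′} e e′ n → trans (Lin.⟦⟧-cong ⋆-bilinear {proj₁ x} {proj₁ x′} e (proj₁ y) n)
                                      (Lin.⟦⟧-cong (⋆-bilinear $ proj₁ x′) {proj₁ y} {proj₁ y′} e′ n))
  (λ x x′ y → Lin.+ᴹ-homo ⋆-bilinear (proj₁ x) (proj₁ x′) (proj₁ y))
  (λ r x y → Lin.*ₗ-homo ⋆-bilinear r (proj₁ x) (proj₁ y))
  (λ x y y′ → Lin.+ᴹ-homo (⋆-bilinear $ proj₁ x) (proj₁ y) (proj₁ y′))
  (λ x r y → Lin.*ₗ-homo (⋆-bilinear $ proj₁ x) r (proj₁ y))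

-- The M a are linearly independent, so a map on them extends linearly to DQSym.
module _ {W : ℚ-Space} (k : Bicomposition → ∥ W ∥) where
  private
    module W = Module W
    module SumW = Sum W

    ext : ∀ {s} → Span SeriesSpace M s → ∥ W ∥
    ext (gen a)       = k a
    ext zero          = W.0ᴹ
    ext (add p q)     = ext p W.+ᴹ ext q
    ext (scale r p)   = r W.*ₗ ext p
    ext (respect _ p) = ext p

    generators : ∀ {s} → Span SeriesSpace M s → List Bicomposition
    generators (gen a)       = a ∷ []
    generators zero          = []
    generators (add p q)     = generators p ++ generators q
    generators (scale r p)   = generators p
    generators (respect _ p) = generators p

    module _ {E : List Bicomposition} (E-unique : Unique E) where

      expand : ∀ {s} (p : Span SeriesSpace M s) → (∀ {a} → a ∈ generators p → a ∈ E) →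
               ext p W.≈ᴹ SumW.∑ E (λ a → coeff s (exponents a) W.*ₗ k a)
      expand (gen a) sub = W.≈ᴹ-sym (W.≈ᴹ-trans
        (SumW.∑-at E-unique (sub (here refl))
          (λ b ne → W.≈ᴹ-trans (W.*ₗ-congʳ (trans (coeffM-exponents a b) (⟦⟧-no (b ≟ᵇ a) ne))) (W.*ₗ-zeroˡ (k b))))
        (W.≈ᴹ-trans (W.*ₗ-congʳ (trans (coeffM-exponents a a) (⟦⟧-yes (a ≟ᵇ a) refl))) (W.*ₗ-identityˡ (k a))))
      expand zero sub = W.≈ᴹ-sym (SumW.∑-zero E (λ a _ → W.*ₗ-zeroˡ (k a)))
      expand (add {x} {y} p q) sub = W.≈ᴹ-trans
        (W.+ᴹ-cong (expand p (sub ∘ ∈-++⁺ˡ)) (expand q (sub ∘ ∈-++⁺ʳ (generators p))))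
        (W.≈ᴹ-trans (W.≈ᴹ-sym (SumW.∑-+ E _ _))
          (SumW.∑-cong E (λ a → W.≈ᴹ-sym (W.*ₗ-distribʳ (k a) (coeff x (exponents a)) (coeff y (exponents a))))))
      expand (scale r {x} p) sub = W.≈ᴹ-trans (W.*ₗ-congˡ (expand p sub))
        (W.≈ᴹ-trans (W.≈ᴹ-sym (SumW.∑-* E r _))
          (SumW.∑-cong E (λ a → W.≈ᴹ-sym (W.*ₗ-assoc r (coeff x (exponents a)) (k a)))))
      expand (respect e p) sub = W.≈ᴹ-trans (expand p sub)
        (SumW.∑-cong E (λ a → W.*ₗ-congʳ (e (exponents a))))

    ext-cong : ∀ {s t} (p : Span SeriesSpace M s) (q : Span SeriesSpace M t) →
               s SeriesM.≈ᴹ t → ext p W.≈ᴹ ext q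
    ext-cong {s} {t} p q e = W.≈ᴹ-trans
      (expand E-unique p (∈-deduplicate⁺ _≟ᵇ_ ∘ ∈-++⁺ˡ))
      (W.≈ᴹ-trans (SumW.∑-cong E (λ a → W.*ₗ-congʳ (e (exponents a))))
        (W.≈ᴹ-sym (expand E-unique q (∈-deduplicate⁺ _≟ᵇ_ ∘ ∈-++⁺ʳ (generators p)))))
      where
      E : List Bicomposition
      E = deduplicate _≟ᵇ_ (generators p ++ generators q)
      E-unique : Unique E
      E-unique = DecUnique.deduplicate-! _≟ᵇ_ (generators p ++ generators q)

  extendM : DQSymSpace ⊸ W
  extendM = linear (ext ∘ proj₂) (λ {x} {y} e → ext-cong (proj₂ x) (proj₂ y) e)
    (λ _ _ → W.≈ᴹ-refl) (λ _ _ → W.≈ᴹ-refl)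

module _ {W : ℚ-Space} where
  private module W = Module W

  DQSym-ext : (f g : DQSymSpace ⊸ W) → (∀ a → f $ 𝐌 a W.≈ᴹ g $ 𝐌 a) → ∀ x → f $ x W.≈ᴹ g $ x
  DQSym-ext f g eq (_ , p) = go p
    where
    go : ∀ {s} (p : Span SeriesSpace M s) → f $ (s , p) W.≈ᴹ g $ (s , p)
    go (gen a) = eq a
    go zero = W.≈ᴹ-trans (Lin.0ᴹ-homo f) (W.≈ᴹ-sym (Lin.0ᴹ-homo g))
    go (add {x} {y} p q) = W.≈ᴹ-trans (Lin.+ᴹ-homo f (x , p) (y , q))
      (W.≈ᴹ-trans (W.+ᴹ-cong (go p) (go q)) (W.≈ᴹ-sym (Lin.+ᴹ-homo g (x , p) (y , q))))
    go (scale r {x} p) = W.≈ᴹ-trans (Lin.*ₗ-homo f r (x , p))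
      (W.≈ᴹ-trans (W.*ₗ-congˡ (go p)) (W.≈ᴹ-sym (Lin.*ₗ-homo g r (x , p))))
    go (respect {x} {y} e p) = W.≈ᴹ-trans (W.≈ᴹ-sym (Lin.⟦⟧-cong f {x , p} {y , respect e p} e))
      (W.≈ᴹ-trans (go p) (Lin.⟦⟧-cong g {x , p} {y , respect e p} e))

-- The structure maps of a bigraded Hopf algebra, without the axioms.  The
-- antipode is not listed: it is determined by the other maps, and every
-- isomorphism respecting those respects it.
record RawBigradedHopfAlgebra : Set₁ where
  field
    space     : ℚ-Space
    mul       : Bilinear space space space
    one       : ∥ space ∥
    comul     : space ⊸ space ⊗ space
    counit    : space ⊸ 𝕜
    Component : ℕ² → ∥ space ∥ → Set

  infixl 7 _·_
  _·_ : ∥ space ∥ → ∥ space ∥ → ∥ space ∥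
  x · y = mul $ x $ y

record _≅_ (A B : RawBigradedHopfAlgebra) : Set where
  private
    module A = RawBigradedHopfAlgebra A
    module B = RawBigradedHopfAlgebra B
    module A-space = Module A.space
    module B-space = Module B.space
    module B⊗B = Module (B.space ⊗ B.space)
  field
    φ              : A.space ⊸ B.space
    isIsomorphism  : ModuleMorphisms.IsModuleIsomorphism A-space.rawModule B-space.rawModule (φ $_)
    mul-homo       : ∀ x y → φ $ (x A.· y) B-space.≈ᴹ (φ $ x) B.· (φ $ y)
    one-homo       : φ $ A.one B-space.≈ᴹ B.one
    comul-homo     : ∀ x → tensor φ φ $ (A.comul $ x) B⊗B.≈ᴹ B.comul $ (φ $ x)
    counit-homo    : ∀ x → A.counit $ x ≡ B.counit $ (φ $ x)
    component-homo : ∀ d x → A.Component d x ⇔ B.Component d (φ $ x)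

DQSym : RawBigradedHopfAlgebra
DQSym = record
  { space     = DQSymSpace
  ; mul       = DQSym-mul
  ; one       = 𝐌 []
  ; comul     = extendM {DQSymSpace ⊗ DQSymSpace} (λ c →
      Sum.∑ (DQSymSpace ⊗ DQSymSpace) (deconcatenations c) (λ (a , b) → 𝐌 a ⊗ₑ 𝐌 b))
  ; counit    = extendM {𝕜} (λ a → ⟦ a ≟ᵇ [] ⟧)
  ; Component = λ d → Span DQSymSpace (λ (a : Fibre d) → 𝐌 (proj₁ a))
  }

module DQSym = RawBigradedHopfAlgebra DQSym

DQSym^ : ℕ² → ℚ-Space
DQSym^ d = span DQSymSpace (λ (a : Fibre d) → 𝐌 (proj₁ a))

-- The direct sum of the V d: families with finitely many nonzero members, all of
-- them at some d of total degree below a bound.  The bound is ignored by equality.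
module _ (V : ℕ² → ℚ-Space) where
  private module V d = Module (V d)

  record FiniteFamily : Set where
    constructor family
    field
      at       : ∀ d → ∥ V d ∥
      bound    : ℕ
      vanishes : ∀ d → bound ≤ total d → V._≈ᴹ_ d (at d) (V.0ᴹ d)
  open FiniteFamily

  ⨁ : ℚ-Space
  ⨁ = SpaceAxioms.space {A = FiniteFamily}
    {_≈_ = λ f g → ∀ d → V._≈ᴹ_ d (at f d) (at g d)}
    {_⊞_ = λ f g → family (λ d → V._+ᴹ_ d (at f d) (at g d)) (bound f ⊔ bound g)
      (λ d le → V.≈ᴹ-trans d (V.+ᴹ-cong d (vanishes f d (ℕₚ.≤-trans (ℕₚ.m≤m⊔n (bound f) (bound g)) le))
                                         (vanishes g d (ℕₚ.≤-trans (ℕₚ.m≤n⊔m (bound f) (bound g)) le)))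
                            (V.+ᴹ-identityˡ d (V.0ᴹ d)))}
    {𝟘 = family V.0ᴹ 0 (λ d _ → V.≈ᴹ-refl d)}
    {_⊡_ = λ r f → family (λ d → V._*ₗ_ d r (at f d)) (bound f)
      (λ d le → V.≈ᴹ-trans d (V.*ₗ-congˡ d (vanishes f d le)) (V.*ₗ-zeroʳ d r))}
    (record
      { ≈-refl      = λ d → V.≈ᴹ-refl d
      ; ≈-sym       = λ p d → V.≈ᴹ-sym d (p d)
      ; ≈-trans     = λ p q d → V.≈ᴹ-trans d (p d) (q d)
      ; ⊞-cong      = λ p q d → V.+ᴹ-cong d (p d) (q d)
      ; ⊡-cong      = λ r p d → V.*ₗ-congˡ d (p d)
      ; ⊞-assoc     = λ f g h d → V.+ᴹ-assoc d _ _ _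
      ; ⊞-comm      = λ f g d → V.+ᴹ-comm d _ _
      ; ⊞-identityˡ = λ f d → V.+ᴹ-identityˡ d _
      ; ⊡-distribˡ  = λ r f g d → V.*ₗ-distribˡ d r _ _
      ; ⊡-distribʳ  = λ r s f d → V.*ₗ-distribʳ d _ r s
      ; ⊡-assoc     = λ r s f d → V.*ₗ-assoc d r s _
      ; ⊡-identity  = λ f d → V.*ₗ-identityˡ d _
      ; ⊡-zero      = λ f d → V.*ₗ-zeroˡ d _
      })

open FiniteFamily

DQSym*Space : ℚ-Space
DQSym*Space = ⨁ (λ d → Dual (DQSym^ d))

module D* = Module DQSym*Space
module DD* = Module (DQSym*Space ⊗ DQSym*Space)

zero-map : {V W : ℚ-Space} → V ⊸ W
zero-map {V} {W} = Module.0ᴹ (Hom V W)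

-- The pairing of a family (f_d) of functionals with DQSym = ⨁ DQSym^ d.
⟨_,-⟩ : ∥ DQSym*Space ∥ → DQSymSpace ⊸ 𝕜
⟨ f ,-⟩ = extendM {𝕜} (λ a → at f (bidegree a) $ (𝐌 a , gen (a , refl)))

pairing : Bilinear DQSym*Space DQSymSpace 𝕜
pairing = linear {DQSym*Space} {Dual DQSymSpace} ⟨_,-⟩
  (λ {f} {g} p → DQSym-ext {𝕜} ⟨ f ,-⟩ ⟨ g ,-⟩ (λ a → p (bidegree a) (𝐌 a , gen (a , refl))))
  (λ f g → DQSym-ext {𝕜} ⟨ f D*.+ᴹ g ,-⟩ (⟨ f ,-⟩ H.+ᴹ ⟨ g ,-⟩) (λ a → refl))
  (λ r f → DQSym-ext {𝕜} ⟨ r D*.*ₗ f ,-⟩ (r H.*ₗ ⟨ f ,-⟩) (λ a → refl))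
  where module H = Module (Dual DQSymSpace)

⟨_,_⟩ : ∥ DQSym*Space ∥ → ∥ DQSymSpace ∥ → ℚ
⟨ f , x ⟩ = ⟨ f ,-⟩ $ x

-- On DQSym^ d the pairing is evaluation of the component f_d.
pairing-at : ∀ f d (x : ∥ DQSym^ d ∥) → ⟨ f , proj₁ x ⟩ ≡ at f d $ x
pairing-at f d (_ , p) = go p
  where
  go : ∀ {x} (p : DQSym.Component d x) → ⟨ f , x ⟩ ≡ at f d $ (x , p)
  go (gen (a , refl)) = refl
  go zero = trans (Lin.0ᴹ-homo ⟨ f ,-⟩) (sym (Lin.0ᴹ-homo (at f d)))
  go (add {x} {y} p q) = trans (Lin.+ᴹ-homo ⟨ f ,-⟩ x y)
    (trans (cong₂ _+_ (go p) (go q)) (sym (Lin.+ᴹ-homo (at f d) (x , p) (y , q))))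
  go (scale r {x} p) = trans (Lin.*ₗ-homo ⟨ f ,-⟩ r x)
    (trans (cong (r *_) (go p)) (sym (Lin.*ₗ-homo (at f d) r (x , p))))
  go (respect {x} {y} e p) = trans (sym (Lin.⟦⟧-cong ⟨ f ,-⟩ {x} {y} e))
    (trans (go p) (Lin.⟦⟧-cong (at f d) {x , p} {y , respect e p} e))

pairing-vanishes : ∀ f {d} x → DQSym.Component d x → bound f ≤ total d → ⟨ f , x ⟩ ≡ 0ℚ
pairing-vanishes f {d} x p le = trans (pairing-at f d (x , p)) (vanishes f d le (x , p))

restrict : ∀ d → DQSymSpace ⊸ 𝕜 → DQSym^ d ⊸ 𝕜
restrict d f = _∘ₗ_ {DQSym^ d} {DQSymSpace} {𝕜} f (inclusion DQSymSpace _)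

-- (f ⊠ g)(u ⊗ v) = f(u) g(v)
infixl 7 _⊠_
_⊠_ : {U V : ℚ-Space} → U ⊸ 𝕜 → V ⊸ 𝕜 → U ⊗ V ⊸ 𝕜
_⊠_ {U} {V} f g = uncurry⊗ {U} {V} {𝕜} (bilinear {U} {V} {𝕜} (λ u v → f $ u * g $ v)
  (λ p q → cong₂ _*_ (Lin.⟦⟧-cong f p) (Lin.⟦⟧-cong g q))
  (λ u u′ v → trans (cong (_* g $ v) (Lin.+ᴹ-homo f u u′)) (ℚₚ.*-distribʳ-+ (g $ v) (f $ u) (f $ u′)))
  (λ r u v → trans (cong (_* g $ v) (Lin.*ₗ-homo f r u)) (ℚₚ.*-assoc r (f $ u) (g $ v)))
  (λ u v v′ → trans (cong (f $ u *_) (Lin.+ᴹ-homo g v v′)) (ℚₚ.*-distribˡ-+ (f $ u) (g $ v) (g $ v′)))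
  (λ u r v → trans (cong (f $ u *_) (Lin.*ₗ-homo g r v)) (*-right r (f $ u) (g $ v))))

⊠-bilinear : {U V : ℚ-Space} → Bilinear (Dual U) (Dual V) (Dual (U ⊗ V))
⊠-bilinear {U} {V} = bilinear {Dual U} {Dual V} {Dual (U ⊗ V)} (_⊠_ {U} {V})
  (λ {f} {f′} {g} {g′} p q → ⊗-ext {U} {V} {𝕜} (_⊠_ {U} {V} f g) (_⊠_ {U} {V} f′ g′)
    (λ u v → cong₂ _*_ (p u) (q v)))
  (λ f f′ g → ⊗-ext {U} {V} {𝕜} (_⊠_ {U} {V} (f U*.+ᴹ f′) g) (_⊠_ {U} {V} f g H.+ᴹ _⊠_ {U} {V} f′ g)
    (λ u v → ℚₚ.*-distribʳ-+ (g $ v) (f $ u) (f′ $ u)))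
  (λ r f g → ⊗-ext {U} {V} {𝕜} (_⊠_ {U} {V} (r U*.*ₗ f) g) (r H.*ₗ _⊠_ {U} {V} f g)
    (λ u v → ℚₚ.*-assoc r (f $ u) (g $ v)))
  (λ f g g′ → ⊗-ext {U} {V} {𝕜} (_⊠_ {U} {V} f (g V*.+ᴹ g′)) (_⊠_ {U} {V} f g H.+ᴹ _⊠_ {U} {V} f g′)
    (λ u v → ℚₚ.*-distribˡ-+ (f $ u) (g $ v) (g′ $ v)))
  (λ f r g → ⊗-ext {U} {V} {𝕜} (_⊠_ {U} {V} f (r V*.*ₗ g)) (r H.*ₗ _⊠_ {U} {V} f g)
    (λ u v → *-right r (f $ u) (g $ v)))
  where
  module U* = Module (Dual U)
  module V* = Module (Dual V)
  module H = Module (Dual (U ⊗ V))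

convolution : ∥ DQSym*Space ∥ → ∥ DQSym*Space ∥ → DQSymSpace ⊸ 𝕜
convolution f g = _∘ₗ_ {DQSymSpace} {DQSymSpace ⊗ DQSymSpace} {𝕜}
  (_⊠_ {DQSymSpace} {DQSymSpace} ⟨ f ,-⟩ ⟨ g ,-⟩) DQSym.comul

sum²-++ : ∀ e e′ → sum² (e ++ e′) ≡ sum² e +² sum² e′
sum²-++ []      e′ = refl
sum²-++ ((a , b) ∷ e) e′ = trans (cong ((a , b) +²_) (sum²-++ e e′))
  (cong₂ _,_ (sym (ℕₚ.+-assoc a _ _)) (sym (ℕₚ.+-assoc b _ _)))

deconcatenations-++ : {A : Set} (xs : List A) {ys zs : List A} →
                      (ys , zs) ∈ deconcatenations xs → ys ++ zs ≡ xs
deconcatenations-++ []       (here refl) = refl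
deconcatenations-++ (x ∷ xs) (here refl) = refl
deconcatenations-++ (x ∷ xs) (there m) with ∈-map⁻ _ m
... | _ , m′ , refl = cong (x ∷_) (deconcatenations-++ xs m′)

deconcatenations-degree : ∀ c {a b} → (a , b) ∈ deconcatenations c →
                          bidegree a +² bidegree b ≡ bidegree c
deconcatenations-degree c {a} {b} m = trans (sym (sum²-++ (exponents a) (exponents b)))
  (cong sum² (trans (sym (List.map-++ value a b)) (cong exponents (deconcatenations-++ c m))))

+-bounds : ∀ m n {p q} → m ℕ.+ n ≤ p ℕ.+ q → m ≤ p ⊎ n ≤ q
+-bounds m n {p} {q} le with m ℕₚ.≤? p
... | yes m≤p = inj₁ m≤p
... | no m≰p with n ℕₚ.≤? q
...   | yes n≤q = inj₂ n≤q
...   | no n≰q = contradiction (ℕₚ.≤-trans (ℕₚ.+-mono-< (ℕₚ.≰⇒> m≰p) (ℕₚ.≰⇒> n≰q)) le) (ℕₚ.<-irrefl refl)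

convolution-M : ∀ f g c → bound f ℕ.+ bound g ≤ total (bidegree c) → convolution f g $ 𝐌 c ≡ 0ℚ
convolution-M f g c le = trans
  (linear-∑ (_⊠_ {DQSymSpace} {DQSymSpace} ⟨ f ,-⟩ ⟨ g ,-⟩) (deconcatenations c) _)
  (∑-zero (deconcatenations c) (λ (a , b) m → vanish a b
    (+-bounds (bound f) (bound g) (subst (bound f ℕ.+ bound g ≤_)
      (trans (cong total (sym (deconcatenations-degree c m))) (total-+² (bidegree a) (bidegree b))) le))))
  where
  vanish : ∀ a b → bound f ≤ total (bidegree a) ⊎ bound g ≤ total (bidegree b) →
           ⟨ f , 𝐌 a ⟩ * ⟨ g , 𝐌 b ⟩ ≡ 0ℚ
  vanish a b (inj₁ le) = trans (cong (_* ⟨ g , 𝐌 b ⟩) (pairing-vanishes f (𝐌 a) (gen (a , refl)) le))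
                               (ℚₚ.*-zeroˡ ⟨ g , 𝐌 b ⟩)
  vanish a b (inj₂ le) = trans (cong (⟨ f , 𝐌 a ⟩ *_) (pairing-vanishes g (𝐌 b) (gen (b , refl)) le))
                               (ℚₚ.*-zeroʳ ⟨ f , 𝐌 a ⟩)

-- (f g)(x) = (f ⊗ g)(Δ x)
DQSym*-mul : Bilinear DQSym*Space DQSym*Space DQSym*Space
DQSym*-mul = bilinear {DQSym*Space} {DQSym*Space} {DQSym*Space}
  (λ f g → family (λ d → restrict d (convolution f g)) (bound f ℕ.+ bound g)
    (λ d le (x , p) → linear-span {DQSymSpace} {𝕜} (convolution f g) (zero-map {DQSymSpace} {𝕜})
      (λ (c , eq) → convolution-M f g c (subst (λ d → bound f ℕ.+ bound g ≤ total d) (sym eq) le)) p))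
  (λ {f} {f′} {g} {g′} p q d (x , _) → trans
    (Lin.⟦⟧-cong β {⟨ f ,-⟩} {⟨ f′ ,-⟩} (Lin.⟦⟧-cong pairing {f} {f′} p) ⟨ g ,-⟩ (DQSym.comul $ x))
    (Lin.⟦⟧-cong (β $ ⟨ f′ ,-⟩) {⟨ g ,-⟩} {⟨ g′ ,-⟩} (Lin.⟦⟧-cong pairing {g} {g′} q) (DQSym.comul $ x)))
  (λ f f′ g d (x , _) → trans
    (Lin.⟦⟧-cong β {⟨ f D*.+ᴹ f′ ,-⟩} {⟨ f ,-⟩ H.+ᴹ ⟨ f′ ,-⟩} (Lin.+ᴹ-homo pairing f f′) ⟨ g ,-⟩ (DQSym.comul $ x))
    (Lin.+ᴹ-homo β ⟨ f ,-⟩ ⟨ f′ ,-⟩ ⟨ g ,-⟩ (DQSym.comul $ x)))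
  (λ r f g d (x , _) → trans
    (Lin.⟦⟧-cong β {⟨ r D*.*ₗ f ,-⟩} {r H.*ₗ ⟨ f ,-⟩} (Lin.*ₗ-homo pairing r f) ⟨ g ,-⟩ (DQSym.comul $ x))
    (Lin.*ₗ-homo β r ⟨ f ,-⟩ ⟨ g ,-⟩ (DQSym.comul $ x)))
  (λ f g g′ d (x , _) → trans
    (Lin.⟦⟧-cong (β $ ⟨ f ,-⟩) {⟨ g D*.+ᴹ g′ ,-⟩} {⟨ g ,-⟩ H.+ᴹ ⟨ g′ ,-⟩} (Lin.+ᴹ-homo pairing g g′) (DQSym.comul $ x))
    (Lin.+ᴹ-homo (β $ ⟨ f ,-⟩) ⟨ g ,-⟩ ⟨ g′ ,-⟩ (DQSym.comul $ x)))
  (λ f r g d (x , _) → trans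
    (Lin.⟦⟧-cong (β $ ⟨ f ,-⟩) {⟨ r D*.*ₗ g ,-⟩} {r H.*ₗ ⟨ g ,-⟩} (Lin.*ₗ-homo pairing r g) (DQSym.comul $ x))
    (Lin.*ₗ-homo (β $ ⟨ f ,-⟩) r ⟨ g ,-⟩ (DQSym.comul $ x)))
  where
  module H = Module (Dual DQSymSpace)
  β : Bilinear (Dual DQSymSpace) (Dual DQSymSpace) (Dual (DQSymSpace ⊗ DQSymSpace))
  β = ⊠-bilinear {DQSymSpace} {DQSymSpace}

-- The dual basis: by coeffM-exponents, the coefficient of M a in a combination
-- of the M b is its coefficient as a series at the exponents listed in a.
𝐌* : Bicomposition → ∥ DQSym*Space ∥
𝐌* a = family (λ d → restrict d coordinate) (suc (total (bidegree a)))
  (λ d le (x , p) → linear-span {DQSymSpace} {𝕜} coordinate (zero-map {DQSymSpace} {𝕜})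
    (λ (b , eq) → coeffM-degree b (exponents a)
      (λ eq′ → ℕₚ.<-irrefl (cong total (trans eq′ eq)) le)) p)
  where
  coordinate : DQSymSpace ⊸ 𝕜
  coordinate = _∘ₗ_ {DQSymSpace} {SeriesSpace} {𝕜} (coefficient (exponents a)) (inclusion SeriesSpace M)

pairs : ℕ → List (Bicomposition × Bicomposition)
pairs n = cartesianProduct (bicompositions n) (bicompositions n)

pairs-unique : ∀ n → Unique (pairs n)
pairs-unique n = cartesianProduct⁺ (words-unique n n) (words-unique n n)

_≟ᵖ_ : DecidableEquality (Bicomposition × Bicomposition)
_≟ᵖ_ = Product.≡-dec _≟ᵇ_ _≟ᵇ_

lift-component : ∀ {d s} → Span SeriesSpace (λ (a : Fibre d) → M (proj₁ a)) s →
                 (p : Span SeriesSpace M s) → DQSym.Component d (s , p)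
lift-component {d} q p = respect (λ _ → refl) (go q)
  where
  go : ∀ {s} (q : Span SeriesSpace (λ (a : Fibre d) → M (proj₁ a)) s) → DQSym.Component d (s , forget q)
  go (gen i)       = gen i
  go zero          = zero
  go (add p q)     = add (go p) (go q)
  go (scale r p)   = scale r (go p)
  go (respect e p) = respect e (go p)

M·M-component : ∀ a b → DQSym.Component (bidegree a +² bidegree b) (𝐌 a DQSym.· 𝐌 b)
M·M-component a b = lift-component (M-⋆ a b) (proj₂ (𝐌 a DQSym.· 𝐌 b))

coefficient* : ∥ DQSym*Space ∥ → Bicomposition × Bicomposition → ℚ
coefficient* f (a , b) = ⟨ f , 𝐌 a DQSym.· 𝐌 b ⟩

coefficient*-out : ∀ f ab → ab ∉ pairs (bound f) → coefficient* f ab ≡ 0ℚ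
coefficient*-out f (a , b) out = pairing-vanishes f (𝐌 a DQSym.· 𝐌 b) (M·M-component a b)
  (subst (bound f ≤_) (sym (total-+² (bidegree a) (bidegree b))) large)
  where
  large : bound f ≤ total (bidegree a) ℕ.+ total (bidegree b)
  large with total (bidegree a) ℕₚ.≤? bound f | total (bidegree b) ℕₚ.≤? bound f
  ... | yes p | yes q = contradiction
    (∈-cartesianProduct⁺ (∈-bicompositions (bound f) a p) (∈-bicompositions (bound f) b q)) out
  ... | no ¬p | _ = ℕₚ.≤-trans (ℕₚ.<⇒≤ (ℕₚ.≰⇒> ¬p)) (ℕₚ.m≤m+n (total (bidegree a)) (total (bidegree b)))
  ... | _ | no ¬q = ℕₚ.≤-trans (ℕₚ.<⇒≤ (ℕₚ.≰⇒> ¬q)) (ℕₚ.m≤n+m (total (bidegree b)) (total (bidegree a)))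

term* : ∥ DQSym*Space ∥ → Bicomposition × Bicomposition → ∥ DQSym*Space ⊗ DQSym*Space ∥
term* f (a , b) = coefficient* f (a , b) DD*.*ₗ (𝐌* a ⊗ₑ 𝐌* b)

term*-out : ∀ f ab → ab ∉ pairs (bound f) → term* f ab DD*.≈ᴹ DD*.0ᴹ
term*-out f (a , b) out = DD*.≈ᴹ-trans (DD*.*ₗ-congʳ (coefficient*-out f (a , b) out)) (DD*.*ₗ-zeroˡ _)

module S* = Sum (DQSym*Space ⊗ DQSym*Space)

support* : ∀ f n → (∀ ab → ab ∉ pairs n → term* f ab DD*.≈ᴹ DD*.0ᴹ) →
           S*.∑ (pairs n) (term* f) DD*.≈ᴹ S*.∑ (pairs (bound f)) (term* f)
support* f n out = S*.∑-support _≟ᵖ_ (pairs-unique n) (pairs-unique (bound f)) out (term*-out f)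

grow : ∀ f {n} → bound f ≤ n → ∀ ab → ab ∉ pairs n → term* f ab DD*.≈ᴹ DD*.0ᴹ
grow f {n} le ab out = term*-out f′ ab out
  where
  f′ : ∥ DQSym*Space ∥
  f′ = family (at f) n (λ d le′ → vanishes f d (ℕₚ.≤-trans le le′))

-- Δ f = ∑ f(M_a M_b) M_a* ⊗ M_b* over all a and b, the image of x ⊗ y ↦ f(x y)
-- under the isomorphisms (V ⊗ W)* ≅ V* ⊗ W* for finite-dimensional components.
-- The pairs left out of the finite sum contribute zero; see comul-dual.
DQSym*-comul : DQSym*Space ⊸ DQSym*Space ⊗ DQSym*Space
DQSym*-comul = linear {DQSym*Space} {DQSym*Space ⊗ DQSym*Space} (λ f → S*.∑ (pairs (bound f)) (term* f))
  (λ {f} {g} p → DD*.≈ᴹ-trans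
    (S*.∑-cong (pairs (bound f)) (term-cong f g p))
    (support* g (bound f) (λ ab out → DD*.≈ᴹ-trans (DD*.≈ᴹ-sym (term-cong f g p ab)) (term*-out f ab out))))
  (λ f g → DD*.≈ᴹ-trans
    (S*.∑-cong (pairs (bound f ⊔ bound g)) (λ (a , b) → DD*.≈ᴹ-trans
      (DD*.*ₗ-congʳ (Lin.+ᴹ-homo pairing f g (𝐌 a DQSym.· 𝐌 b)))
      (DD*.*ₗ-distribʳ (𝐌* a ⊗ₑ 𝐌* b) (coefficient* f (a , b)) (coefficient* g (a , b)))))
    (DD*.≈ᴹ-trans (S*.∑-+ (pairs (bound f ⊔ bound g)) (term* f) (term* g))
      (DD*.+ᴹ-cong (support* f (bound f ⊔ bound g) (grow f (ℕₚ.m≤m⊔n (bound f) (bound g))))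
                   (support* g (bound f ⊔ bound g) (grow g (ℕₚ.m≤n⊔m (bound f) (bound g)))))))
  (λ r f → DD*.≈ᴹ-trans
    (S*.∑-cong (pairs (bound f)) (λ (a , b) → DD*.≈ᴹ-trans
      (DD*.*ₗ-congʳ (Lin.*ₗ-homo pairing r f (𝐌 a DQSym.· 𝐌 b)))
      (DD*.*ₗ-assoc r (coefficient* f (a , b)) (𝐌* a ⊗ₑ 𝐌* b))))
    (S*.∑-* (pairs (bound f)) r (term* f)))
  where
  term-cong : ∀ f g → f D*.≈ᴹ g → ∀ ab → term* f ab DD*.≈ᴹ term* g ab
  term-cong f g p (a , b) = DD*.*ₗ-congʳ (Lin.⟦⟧-cong pairing {f} {g} p (𝐌 a DQSym.· 𝐌 b))

DQSym* : RawBigradedHopfAlgebra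
DQSym* = record
  { space     = DQSym*Space
  ; mul       = DQSym*-mul
  ; one       = family (λ d → restrict d DQSym.counit) 1
      (λ d le (x , p) → linear-span {DQSymSpace} {𝕜} DQSym.counit (zero-map {DQSymSpace} {𝕜})
        (λ (a , eq) → ⟦⟧-no (a ≟ᵇ []) (λ a≡[] → contradiction (subst (λ d → 1 ≤ total d) (trans (sym eq) (cong bidegree a≡[])) le) λ ())) p)
  ; comul     = DQSym*-comul
  ; counit    = linear {DQSym*Space} {𝕜} (λ f → ⟨ f , DQSym.one ⟩)
      (λ {f} {g} p → Lin.⟦⟧-cong pairing {f} {g} p DQSym.one)
      (λ f g → Lin.+ᴹ-homo pairing f g DQSym.one) (λ r f → Lin.*ₗ-homo pairing r f DQSym.one)
  ; Component = λ d f → ∀ d′ → d′ ≢ d → Module._≈ᴹ_ (Dual (DQSym^ d′)) (at f d′) (Module.0ᴹ (Dual (DQSym^ d′)))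
  }

module DQSym* = RawBigradedHopfAlgebra DQSym*

-- The product and the coproduct of DQSym* are dual to the coproduct and the product of DQSym.
mul-dual : ∀ f g x → ⟨ f DQSym*.· g , x ⟩ ≡ (_⊠_ {DQSymSpace} {DQSymSpace} ⟨ f ,-⟩ ⟨ g ,-⟩) $ (DQSym.comul $ x)
mul-dual f g = DQSym-ext {𝕜} ⟨ f DQSym*.· g ,-⟩ (convolution f g) (λ a → refl)

⟨-,_⟩ : ∥ DQSymSpace ∥ → DQSym*Space ⊸ 𝕜
⟨-, x ⟩ = linear {DQSym*Space} {𝕜} (λ f → ⟨ f , x ⟩)
  (λ {f} {g} p → Lin.⟦⟧-cong pairing {f} {g} p x)
  (λ f g → Lin.+ᴹ-homo pairing f g x) (λ r f → Lin.*ₗ-homo pairing r f x)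

comul-dual : ∀ f x y → (_⊠_ {DQSym*Space} {DQSym*Space} ⟨-, x ⟩ ⟨-, y ⟩) $ (DQSym*.comul $ f) ≡ ⟨ f , x DQSym.· y ⟩
comul-dual f x y = DQSym-ext {𝕜} (leftˡ y) (rightˡ y)
  (λ a → DQSym-ext {𝕜} (leftʳ (𝐌 a)) (rightʳ (𝐌 a)) (λ b → on-basis a b) y) x
  where
  β : Bilinear (Dual DQSym*Space) (Dual DQSym*Space) (Dual (DQSym*Space ⊗ DQSym*Space))
  β = ⊠-bilinear {DQSym*Space} {DQSym*Space}

  ev : DQSymSpace ⊸ Dual DQSym*Space
  ev = linear {DQSymSpace} {Dual DQSym*Space} ⟨-,_⟩
    (λ {x} {y} p f → Lin.⟦⟧-cong ⟨ f ,-⟩ {x} {y} p)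
    (λ x y f → Lin.+ᴹ-homo ⟨ f ,-⟩ x y) (λ r x f → Lin.*ₗ-homo ⟨ f ,-⟩ r x)

  module H = Module (Dual DQSym*Space)
  module H₂ = Module (Dual (DQSym*Space ⊗ DQSym*Space))

  Δf : ∥ DQSym*Space ⊗ DQSym*Space ∥
  Δf = DQSym*.comul $ f

  leftˡ : ∥ DQSymSpace ∥ → DQSymSpace ⊸ 𝕜
  leftˡ y = linear {DQSymSpace} {𝕜} (λ x → (β $ ⟨-, x ⟩ $ ⟨-, y ⟩) $ Δf)
    (λ {x} {x′} p → Lin.⟦⟧-cong β {⟨-, x ⟩} {⟨-, x′ ⟩} (Lin.⟦⟧-cong ev {x} {x′} p) ⟨-, y ⟩ Δf)
    (λ x x′ → trans
      (Lin.⟦⟧-cong β {⟨-, x DQ.+ᴹ x′ ⟩} {⟨-, x ⟩ H.+ᴹ ⟨-, x′ ⟩} (Lin.+ᴹ-homo ev x x′) ⟨-, y ⟩ Δf)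
      (Lin.+ᴹ-homo β ⟨-, x ⟩ ⟨-, x′ ⟩ ⟨-, y ⟩ Δf))
    (λ r x → trans
      (Lin.⟦⟧-cong β {⟨-, r DQ.*ₗ x ⟩} {r H.*ₗ ⟨-, x ⟩} (Lin.*ₗ-homo ev r x) ⟨-, y ⟩ Δf)
      (Lin.*ₗ-homo β r ⟨-, x ⟩ ⟨-, y ⟩ Δf))
    where module DQ = Module DQSymSpace

  leftʳ : ∥ DQSymSpace ∥ → DQSymSpace ⊸ 𝕜
  leftʳ x = linear {DQSymSpace} {𝕜} (λ y → (β $ ⟨-, x ⟩ $ ⟨-, y ⟩) $ Δf)
    (λ {y} {y′} p → Lin.⟦⟧-cong (β $ ⟨-, x ⟩) {⟨-, y ⟩} {⟨-, y′ ⟩} (Lin.⟦⟧-cong ev {y} {y′} p) Δf)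
    (λ y y′ → trans
      (Lin.⟦⟧-cong (β $ ⟨-, x ⟩) {⟨-, y DQ.+ᴹ y′ ⟩} {⟨-, y ⟩ H.+ᴹ ⟨-, y′ ⟩} (Lin.+ᴹ-homo ev y y′) Δf)
      (Lin.+ᴹ-homo (β $ ⟨-, x ⟩) ⟨-, y ⟩ ⟨-, y′ ⟩ Δf))
    (λ r y → trans
      (Lin.⟦⟧-cong (β $ ⟨-, x ⟩) {⟨-, r DQ.*ₗ y ⟩} {r H.*ₗ ⟨-, y ⟩} (Lin.*ₗ-homo ev r y) Δf)
      (Lin.*ₗ-homo (β $ ⟨-, x ⟩) r ⟨-, y ⟩ Δf))
    where module DQ = Module DQSymSpace

  rightʳ : ∥ DQSymSpace ∥ → DQSymSpace ⊸ 𝕜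
  rightʳ x = _∘ₗ_ {DQSymSpace} {DQSymSpace} {𝕜} ⟨ f ,-⟩ (DQSym.mul $ x)

  rightˡ : ∥ DQSymSpace ∥ → DQSymSpace ⊸ 𝕜
  rightˡ y = linear {DQSymSpace} {𝕜} (λ x → ⟨ f , x DQSym.· y ⟩)
    (λ {x} {x′} p → Lin.⟦⟧-cong ⟨ f ,-⟩ {x DQSym.· y} {x′ DQSym.· y} (Lin.⟦⟧-cong DQSym.mul {x} {x′} p y))
    (λ x x′ → trans
      (Lin.⟦⟧-cong ⟨ f ,-⟩ {(x DQ.+ᴹ x′) DQSym.· y} {x DQSym.· y DQ.+ᴹ x′ DQSym.· y} (Lin.+ᴹ-homo DQSym.mul x x′ y))
      (Lin.+ᴹ-homo ⟨ f ,-⟩ (x DQSym.· y) (x′ DQSym.· y)))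
    (λ r x → trans
      (Lin.⟦⟧-cong ⟨ f ,-⟩ {(r DQ.*ₗ x) DQSym.· y} {r DQ.*ₗ (x DQSym.· y)} (Lin.*ₗ-homo DQSym.mul r x y))
      (Lin.*ₗ-homo ⟨ f ,-⟩ r (x DQSym.· y)))
    where module DQ = Module DQSymSpace

  on-basis : ∀ a b → (_⊠_ {DQSym*Space} {DQSym*Space} ⟨-, 𝐌 a ⟩ ⟨-, 𝐌 b ⟩) $ Δf ≡ ⟨ f , 𝐌 a DQSym.· 𝐌 b ⟩
  on-basis a b = trans (linear-∑ {DQSym*Space ⊗ DQSym*Space} {𝕜} (_⊠_ {DQSym*Space} {DQSym*Space} ⟨-, 𝐌 a ⟩ ⟨-, 𝐌 b ⟩) (pairs (bound f)) (term* f)) (begin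
    ∑ (pairs (bound f)) summand ≡⟨ Sum.∑-at′ 𝕜 _≟ᵖ_ (a , b) (pairs-unique (bound f)) off out ⟩
    summand (a , b) ≡⟨ cong (coefficient* f (a , b) *_) (cong₂ _*_ (diagonal a) (diagonal b)) ⟩
    coefficient* f (a , b) * (1ℚ * 1ℚ) ≡⟨ ℚₚ.*-identityʳ (coefficient* f (a , b)) ⟩
    coefficient* f (a , b) ∎)
    where
    summand : Bicomposition × Bicomposition → ℚ
    summand (a′ , b′) = coefficient* f (a′ , b′) * (coeffM a (exponents a′) * coeffM b (exponents b′))
    diagonal : ∀ a → coeffM a (exponents a) ≡ 1ℚ
    diagonal a = trans (coeffM-exponents a a) (⟦⟧-yes (a ≟ᵇ a) refl)
    kill : ∀ c {u} → u ≡ 0ℚ → c * u ≡ 0ℚ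
    kill c refl = ℚₚ.*-zeroʳ c
    off : ∀ ab → ab ≢ (a , b) → summand ab ≡ 0ℚ
    off (a′ , b′) ne = go (a′ ≟ᵇ a) (b′ ≟ᵇ b)
      where
      go : Dec (a′ ≡ a) → Dec (b′ ≡ b) → summand (a′ , b′) ≡ 0ℚ
      go (yes a′≡a) (yes b′≡b) = contradiction (cong₂ _,_ a′≡a b′≡b) ne
      go (no a′≢a) _ = kill (coefficient* f (a′ , b′)) (trans
        (cong (_* coeffM b (exponents b′)) (trans (coeffM-exponents a a′) (⟦⟧-no (a′ ≟ᵇ a) a′≢a)))
        (ℚₚ.*-zeroˡ (coeffM b (exponents b′))))
      go _ (no b′≢b) = kill (coefficient* f (a′ , b′)) (trans
        (cong (coeffM a (exponents a′) *_) (trans (coeffM-exponents b b′) (⟦⟧-no (b′ ≟ᵇ b) b′≢b)))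
        (ℚₚ.*-zeroʳ (coeffM a (exponents a′))))
    out : (a , b) ∉ pairs (bound f) → summand (a , b) ≡ 0ℚ
    out ∉P = trans (cong (_* (coeffM a (exponents a) * coeffM b (exponents b))) (coefficient*-out f (a , b) ∉P))
      (ℚₚ.*-zeroˡ (coeffM a (exponents a) * coeffM b (exponents b)))

-- The free algebra on the letters 𝔥 α, α ≠ 0: its basis consists of the words,
-- multiplied by concatenation.  A word is recorded by its list of indices.
DNSymSpace : ℚ-Space
DNSymSpace = Free (List ℕ²₊)

DNSym-mul : Bilinear DNSymSpace DNSymSpace DNSymSpace
DNSym-mul = extendFree {W = Hom DNSymSpace DNSymSpace} (λ v →
  extendFree {W = DNSymSpace} (λ w → gen (v ++ w)))

𝔥 : ℕ² → ∥ DNSymSpace ∥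
𝔥 α with α ≟² 0²
... | yes _  = gen []
... | no α≢0 = gen ((α , [ α≢0 ]) ∷ [])

Δ𝔥 : ℕ² → ∥ DNSymSpace ⊗ DNSymSpace ∥
Δ𝔥 α = Sum.∑ (DNSymSpace ⊗ DNSymSpace) (splits α) (λ (β , γ) → 𝔥 β ⊗ₑ 𝔥 γ)

-- The coproduct (counit) of a word is the product of those of its letters, so
-- both maps are multiplicative.
DNSym : RawBigradedHopfAlgebra
DNSym = record
  { space     = DNSymSpace
  ; mul       = DNSym-mul
  ; one       = gen []
  ; comul     = extendFree {W = DNSymSpace ⊗ DNSymSpace}
      (foldr (λ α t → ⊗-mul {DNSymSpace} DNSym-mul $ Δ𝔥 (value α) $ t) (gen [] ⊗ₑ gen []))
  ; counit    = extendFree {W = 𝕜} (foldr (λ α r → ⟦ value α ≟² 0² ⟧ * r) 1ℚ)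
  ; Component = λ d → Span DNSymSpace (λ (w : Fibre d) → gen (proj₁ w))
  }

{-# OPTIONS --safe #-}
module Submission where

-- Both algebras have bases indexed by bicompositions: DNSym has the words w in
-- the letters 𝔥 α, and DQSym* has the basis 𝐌* dual to the monomial basis 𝐌.
-- The isomorphism φ sends the word w to 𝐌* w.  It is bijective with inverse
-- ψ f = ∑ ⟨ f , 𝐌 a ⟩ a, a sum that is finite because f lives in bounded degree.
--
-- An element of DQSym* is determined by its pairings with the 𝐌 a (DQSym*-ext).
-- This settles the product: 𝐌* v · 𝐌* w takes at 𝐌 c the number of
-- deconcatenations of c into v and w, which is 1 if c = v ++ w and 0 otherwise
-- (𝐌*-++).
--
-- For the coproduct, both sides are identified with one sum over the ways
-- (p , q) of writing the letters α₁, …, αₖ of a word w entrywise as pᵢ + qᵢ.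
-- Expanding Δ 𝔥(α₁) ⋯ Δ 𝔥(αₖ) gives ∑ pack p ⊗ pack q, as 𝔥 0 = 1 makes zero
-- entries disappear (comul-word).  Dually, the coefficient of 𝐌* a ⊗ 𝐌* b in
-- the coproduct of 𝐌* w is the coefficient of 𝐌 a · 𝐌 b at the monomial with
-- exponents w; by the Cauchy product it counts the (p , q) with pack p = a and
-- pack q = b (comul-𝐌*).

open import Defs
open import Algebra.Module.Bundles using (Module)
open import Data.List.Base using (List; []; _∷_; _++_; map; cartesianProductWith)
open import Data.List.Membership.Propositional using (_∈_; _∉_)
open import Data.List.Membership.Propositional.Properties using (∈-map⁻; ∈-map⁺; ∈-cartesianProduct⁺)
open import Data.List.Relation.Unary.All as All using ([]; _∷_)
open import Data.List.Relation.Unary.AllPairs using ([]; _∷_)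
open import Data.List.Relation.Unary.Any using (here; there)
open import Data.List.Relation.Unary.Unique.Propositional using (Unique)
open import Data.List.Relation.Unary.Unique.Propositional.Properties as Unique using ()
open import Data.Nat.Base as ℕ using (_≤_; _⊔_)
import Data.Nat.Properties as ℕₚ
open import Data.Product.Base using (_×_; _,_; proj₁; proj₂)
open import Data.Rational.Base using (ℚ; 0ℚ; 1ℚ; _*_)
import Data.Rational.Properties as ℚₚ
open import Data.Refinement.Base using (value)
open import Data.Sum.Base using (_⊎_; inj₁; inj₂)
open import Function.Bundles using (mk⇔)
open import Relation.Binary.PropositionalEquality
  using (_≡_; _≢_; refl; sym; trans; cong; cong₂; subst)
open import Relation.Nullary using (Dec; yes; no; contradiction)

open FiniteFamily

-- Linear algebra: extensionality and finite sums

module _ {B : Set} {W : ℚ-Space} where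
  private module W = Module W

  Free-ext : (f g : Free B ⊸ W) → (∀ b → f $ gen b W.≈ᴹ g $ gen b) → ∀ x → f $ x W.≈ᴹ g $ x
  Free-ext f g p (gen b) = p b
  Free-ext f g p 𝟘       = W.≈ᴹ-trans (Lin.0ᴹ-homo f) (W.≈ᴹ-sym (Lin.0ᴹ-homo g))
  Free-ext f g p (x ⊞ y) = W.≈ᴹ-trans (Lin.+ᴹ-homo f x y) (W.≈ᴹ-trans
    (W.+ᴹ-cong (Free-ext f g p x) (Free-ext f g p y)) (W.≈ᴹ-sym (Lin.+ᴹ-homo g x y)))
  Free-ext f g p (r ⊡ x) = W.≈ᴹ-trans (Lin.*ₗ-homo f r x) (W.≈ᴹ-trans
    (W.*ₗ-congˡ (Free-ext f g p x)) (W.≈ᴹ-sym (Lin.*ₗ-homo g r x)))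

identity : {V : ℚ-Space} → V ⊸ V
identity {V} = linear {V} {V} (λ x → x) (λ p → p)
  (λ _ _ → Module.≈ᴹ-refl V) (λ _ _ → Module.≈ᴹ-refl V)

postcompose : {U V W : ℚ-Space} → (V ⊸ W) → Hom U V ⊸ Hom U W
postcompose {U} {V} {W} f = linear {Hom U V} {Hom U W} (_∘ₗ_ {U} {V} {W} f)
  (λ p x → Lin.⟦⟧-cong f (p x))
  (λ g h x → Lin.+ᴹ-homo f (g $ x) (h $ x))
  (λ r g x → Lin.*ₗ-homo f r (g $ x))

precompose : {U V W : ℚ-Space} → (U ⊸ V) → Hom V W ⊸ Hom U W
precompose {U} {V} {W} f = linear {Hom V W} {Hom U W} (λ g → _∘ₗ_ {U} {V} {W} g f)
  (λ p x → p (f $ x))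
  (λ _ _ _ → Module.≈ᴹ-refl W)
  (λ _ _ _ → Module.≈ᴹ-refl W)

module SumProperties (V : ℚ-Space) where
  open Module V
  open Sum V

  ∑-cong-∈ : {I : Set} (is : List I) {F F′ : I → ∥ V ∥} →
             (∀ i → i ∈ is → F i ≈ᴹ F′ i) → ∑ is F ≈ᴹ ∑ is F′
  ∑-cong-∈ []       p = ≈ᴹ-refl
  ∑-cong-∈ (i ∷ is) p = +ᴹ-cong (p i (here refl)) (∑-cong-∈ is (λ j j∈ → p j (there j∈)))

  ∑-cartesianProductWith : {I J K : Set} (f : I → J → K) (is : List I) (js : List J) (F : K → ∥ V ∥) →
    ∑ (cartesianProductWith f is js) F ≈ᴹ ∑ is (λ i → ∑ js (λ j → F (f i j)))
  ∑-cartesianProductWith f []       js F = ≈ᴹ-refl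
  ∑-cartesianProductWith f (i ∷ is) js F = ≈ᴹ-trans
    (∑-++ (map (f i) js) (cartesianProductWith f is js) F)
    (+ᴹ-cong (≈ᴹ-reflexive (∑-map (f i) js F)) (∑-cartesianProductWith f is js F))

  ∑-*ʳ : {I : Set} (is : List I) (r : I → ℚ) (v : ∥ V ∥) →
         (Sum.∑ 𝕜 is r *ₗ v) ≈ᴹ ∑ is (λ i → r i *ₗ v)
  ∑-*ʳ []       r v = *ₗ-zeroˡ v
  ∑-*ʳ (i ∷ is) r v = ≈ᴹ-trans (*ₗ-distribʳ v (r i) _) (+ᴹ-congˡ (∑-*ʳ is r v))

module _ {U V W : ℚ-Space} where
  private
    module W = Module W

  bilinear-∑ : (f : Bilinear U V W) {I J : Set}
    (is : List I) (F : I → ∥ U ∥) (js : List J) (G : J → ∥ V ∥) →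
    f $ Sum.∑ U is F $ Sum.∑ V js G W.≈ᴹ Sum.∑ W is (λ i → Sum.∑ W js (λ j → f $ F i $ G j))
  bilinear-∑ f []       F js G = Lin.0ᴹ-homo f (Sum.∑ V js G)
  bilinear-∑ f (i ∷ is) F js G = W.≈ᴹ-trans (Lin.+ᴹ-homo f (F i) (Sum.∑ U is F) (Sum.∑ V js G))
    (W.+ᴹ-cong (linear-∑ {V} {W} (f $ F i) js G) (bilinear-∑ f is F js G))

-- The pairing of DQSym* with DQSym

-- The pairing is nondegenerate on the left.
DQSym*-ext : ∀ f g → (∀ a → ⟨ f , 𝐌 a ⟩ ≡ ⟨ g , 𝐌 a ⟩) → f D*.≈ᴹ g
DQSym*-ext f g eq d x = trans (sym (pairing-at f d x))
  (trans (DQSym-ext {𝕜} ⟨ f ,-⟩ ⟨ g ,-⟩ eq (proj₁ x)) (pairing-at g d x))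

-- The coefficient of a series at the monomial whose exponents are listed in a.
coordinate : Bicomposition → DQSymSpace ⊸ 𝕜
coordinate a = _∘ₗ_ {DQSymSpace} {SeriesSpace} {𝕜} (coefficient (exponents a)) (inclusion SeriesSpace M)

⟨𝐌*,-⟩ : ∀ a x → ⟨ 𝐌* a , x ⟩ ≡ coordinate a $ x
⟨𝐌*,-⟩ a = DQSym-ext {𝕜} ⟨ 𝐌* a ,-⟩ (coordinate a) (λ b → refl)

⟨𝐌*,𝐌⟩ : ∀ a b → ⟨ 𝐌* a , 𝐌 b ⟩ ≡ ⟦ a ≟ᵇ b ⟧
⟨𝐌*,𝐌⟩ a b = coeffM-exponents b a

⟦⟧-× : {P Q R : Set} (p : Dec P) (q : Dec Q) (r : Dec R) →
       (P → Q → R) → (R → P) → (R → Q) → ⟦ p ⟧ * ⟦ q ⟧ ≡ ⟦ r ⟧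
⟦⟧-× (yes p) (yes q) r f g h = trans (ℚₚ.*-identityʳ 1ℚ) (sym (⟦⟧-yes r (f p q)))
⟦⟧-× (yes p) (no ¬q) r f g h = trans (ℚₚ.*-zeroʳ 1ℚ) (sym (⟦⟧-no r (λ x → ¬q (h x))))
⟦⟧-× (no ¬p) q       r f g h = trans (ℚₚ.*-zeroˡ ⟦ q ⟧) (sym (⟦⟧-no r (λ x → ¬p (g x))))

-- The linear isomorphism

-- The isomorphism sends a word to the dual basis element with the same index.
φ : DNSymSpace ⊸ DQSym*Space
φ = extendFree {W = DQSym*Space} 𝐌*

private
  module A = Module DNSymSpace
  module AA = Module (DNSymSpace ⊗ DNSymSpace)
  module SA = Sum DNSymSpace
  module DNSym = RawBigradedHopfAlgebra DNSym

-- The contribution of a to the expansion of f in the dual basis, with 𝐌* a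
-- replaced by the word a.
ψ-term : ∥ DQSym*Space ∥ → Bicomposition → ∥ DNSymSpace ∥
ψ-term f a = ⟨ f , 𝐌 a ⟩ ⊡ gen a

ψ-term-cong : ∀ f g → f D*.≈ᴹ g → ∀ a → ψ-term f a A.≈ᴹ ψ-term g a
ψ-term-cong f g p a = A.*ₗ-congʳ (Lin.⟦⟧-cong pairing {f} {g} p (𝐌 a))

⟨,𝐌⟩-vanishes : ∀ f n → bound f ≤ n → ∀ a → a ∉ bicompositions n → ⟨ f , 𝐌 a ⟩ ≡ 0ℚ
⟨,𝐌⟩-vanishes f n le a out = pairing-vanishes f (𝐌 a) (gen (a , refl)) (large (ℕₚ.≤-total (total (bidegree a)) n))
  where
  large : total (bidegree a) ≤ n ⊎ n ≤ total (bidegree a) → bound f ≤ total (bidegree a)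
  large (inj₁ p) = contradiction (∈-bicompositions n a p) out
  large (inj₂ p) = ℕₚ.≤-trans le p

ψ-term-vanishes : ∀ f n → bound f ≤ n → ∀ a → a ∉ bicompositions n → ψ-term f a A.≈ᴹ A.0ᴹ
ψ-term-vanishes f n le a out = A.≈ᴹ-trans (A.*ₗ-congʳ (⟨,𝐌⟩-vanishes f n le a out)) (A.*ₗ-zeroˡ _)

-- The inverse of φ.  The sum runs over the bicompositions of total degree at
-- most the bound of f, and some more; ψ-sum-grow compares it with the sums for
-- other bounds, which is needed because equality in DQSym* ignores the bound.
ψ-sum : ∥ DQSym*Space ∥ → ∥ DNSymSpace ∥
ψ-sum f = SA.∑ (bicompositions (bound f)) (ψ-term f)

ψ-sum-grow : ∀ f n → (∀ a → a ∉ bicompositions n → ψ-term f a A.≈ᴹ A.0ᴹ) →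
             SA.∑ (bicompositions n) (ψ-term f) A.≈ᴹ ψ-sum f
ψ-sum-grow f n out = SA.∑-support _≟ᵇ_ (words-unique n n) (words-unique (bound f) (bound f))
  out (ψ-term-vanishes f (bound f) ℕₚ.≤-refl)

ψ : DQSym*Space ⊸ DNSymSpace
ψ = linear {DQSym*Space} {DNSymSpace} ψ-sum
  (λ {f} {g} p → A.≈ᴹ-trans (SA.∑-cong (bicompositions (bound f)) (ψ-term-cong f g p))
    (ψ-sum-grow g (bound f) (λ a out → A.≈ᴹ-trans (A.≈ᴹ-sym (ψ-term-cong f g p a))
      (ψ-term-vanishes f (bound f) ℕₚ.≤-refl a out))))
  (λ f g → A.≈ᴹ-trans
    (SA.∑-cong (bicompositions (bound f ⊔ bound g)) (λ a → A.≈ᴹ-trans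
      (A.*ₗ-congʳ (Lin.+ᴹ-homo pairing f g (𝐌 a))) (A.*ₗ-distribʳ (gen a) ⟨ f , 𝐌 a ⟩ ⟨ g , 𝐌 a ⟩)))
    (A.≈ᴹ-trans (SA.∑-+ (bicompositions (bound f ⊔ bound g)) (ψ-term f) (ψ-term g))
      (A.+ᴹ-cong
        (ψ-sum-grow f _ (ψ-term-vanishes f _ (ℕₚ.m≤m⊔n (bound f) (bound g))))
        (ψ-sum-grow g _ (ψ-term-vanishes g _ (ℕₚ.m≤n⊔m (bound f) (bound g)))))))
  (λ r f → A.≈ᴹ-trans
    (SA.∑-cong (bicompositions (bound f)) (λ a → A.≈ᴹ-trans
      (A.*ₗ-congʳ (Lin.*ₗ-homo pairing r f (𝐌 a))) (A.*ₗ-assoc r ⟨ f , 𝐌 a ⟩ (gen a))))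
    (SA.∑-* (bicompositions (bound f)) r (ψ-term f)))

ψ-𝐌* : ∀ a → ψ $ 𝐌* a A.≈ᴹ gen a
ψ-𝐌* a = A.≈ᴹ-trans
  (SA.∑-at {is = bicompositions n} {ψ-term (𝐌* a)} (words-unique n n)
    (∈-bicompositions n a (ℕₚ.n≤1+n (total (bidegree a))))
    (λ b ne → A.≈ᴹ-trans
      (A.*ₗ-congʳ (trans (⟨𝐌*,𝐌⟩ a b) (⟦⟧-no (a ≟ᵇ b) (λ e → ne (sym e))))) (A.*ₗ-zeroˡ (gen b))))
  (A.≈ᴹ-trans (A.*ₗ-congʳ (trans (⟨𝐌*,𝐌⟩ a a) (⟦⟧-yes (a ≟ᵇ a) refl))) (A.*ₗ-identityˡ (gen a)))
  where n = bound (𝐌* a)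

ψ∘φ : ∀ x → ψ $ (φ $ x) A.≈ᴹ x
ψ∘φ = Free-ext {W = DNSymSpace} (_∘ₗ_ {DNSymSpace} {DQSym*Space} {DNSymSpace} ψ φ)
  (identity {DNSymSpace}) ψ-𝐌*

φ∘ψ : ∀ f → φ $ (ψ $ f) D*.≈ᴹ f
φ∘ψ f = DQSym*-ext (φ $ (ψ $ f)) f λ b → trans
  (linear-∑ {DNSymSpace} {𝕜} (_∘ₗ_ {DNSymSpace} {DQSym*Space} {𝕜} ⟨-, 𝐌 b ⟩ φ)
    (bicompositions (bound f)) (ψ-term f))
  (trans (Sum.∑-at′ 𝕜 _≟ᵇ_ b (words-unique (bound f) (bound f)) (off b) (out b))
    (on b))
  where
  on : ∀ b → ⟨ f , 𝐌 b ⟩ * ⟨ 𝐌* b , 𝐌 b ⟩ ≡ ⟨ f , 𝐌 b ⟩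
  on b = trans (cong (⟨ f , 𝐌 b ⟩ *_) (trans (⟨𝐌*,𝐌⟩ b b) (⟦⟧-yes (b ≟ᵇ b) refl)))
    (ℚₚ.*-identityʳ ⟨ f , 𝐌 b ⟩)
  off : ∀ b a → a ≢ b → ⟨ f , 𝐌 a ⟩ * ⟨ 𝐌* a , 𝐌 b ⟩ ≡ 0ℚ
  off b a ne = trans (cong (⟨ f , 𝐌 a ⟩ *_) (trans (⟨𝐌*,𝐌⟩ a b) (⟦⟧-no (a ≟ᵇ b) ne)))
    (ℚₚ.*-zeroʳ ⟨ f , 𝐌 a ⟩)
  out : ∀ b → b ∉ bicompositions (bound f) → ⟨ f , 𝐌 b ⟩ * ⟨ 𝐌* b , 𝐌 b ⟩ ≡ 0ℚ
  out b b∉ = trans (on b) (⟨,𝐌⟩-vanishes f (bound f) ℕₚ.≤-refl b b∉)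

-- The product

-- A word has every factorization exactly once in its list of deconcatenations.
deconcatenations-unique : {X : Set} (xs : List X) → Unique (deconcatenations xs)
deconcatenations-unique []       = [] ∷ []
deconcatenations-unique (x ∷ xs) =
  All.tabulate (λ m p → nonempty (subst (_∈ _) (sym p) m))
  ∷ Unique.map⁺ (λ { refl → refl }) (deconcatenations-unique xs)
  where
  nonempty : ([] , x ∷ xs) ∉ _
  nonempty m with ∈-map⁻ _ m
  ... | _ , _ , ()

++-∈-deconcatenations : {X : Set} (ys zs : List X) → (ys , zs) ∈ deconcatenations (ys ++ zs)
++-∈-deconcatenations []       []       = here refl
++-∈-deconcatenations []       (z ∷ zs) = here refl
++-∈-deconcatenations (y ∷ ys) zs       = there (∈-map⁺ _ (++-∈-deconcatenations ys zs))

𝐌*-++ : ∀ v w → 𝐌* (v ++ w) D*.≈ᴹ 𝐌* v DQSym*.· 𝐌* w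
𝐌*-++ v w = DQSym*-ext (𝐌* (v ++ w)) (𝐌* v DQSym*.· 𝐌* w) λ c → trans (⟨𝐌*,𝐌⟩ (v ++ w) c)
  (sym (trans
    (linear-∑ {DQSymSpace ⊗ DQSymSpace} {𝕜} (_⊠_ {DQSymSpace} {DQSymSpace} ⟨ 𝐌* v ,-⟩ ⟨ 𝐌* w ,-⟩)
      (deconcatenations c) (λ (a , b) → 𝐌 a ⊗ₑ 𝐌 b))
    (trans (Sum.∑-cong 𝕜 (deconcatenations c) (λ (a , b) →
        trans (cong₂ _*_ (⟨𝐌*,𝐌⟩ v a) (⟨𝐌*,𝐌⟩ w b)) (⟦⟧-× (v ≟ᵇ a) (w ≟ᵇ b) ((v , w) ≟ᵖ (a , b))
          (λ { refl refl → refl }) (cong proj₁) (cong proj₂))))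
      (count c ((v ++ w) ≟ᵇ c)))))
  where
  off : ∀ ab → ab ≢ (v , w) → ⟦ (v , w) ≟ᵖ ab ⟧ ≡ 0ℚ
  off ab ne = ⟦⟧-no ((v , w) ≟ᵖ ab) (λ e → ne (sym e))
  count : ∀ c (d : Dec (v ++ w ≡ c)) → Sum.∑ 𝕜 (deconcatenations c) (λ ab → ⟦ (v , w) ≟ᵖ ab ⟧) ≡ ⟦ d ⟧
  count c (yes refl) = trans
    (Sum.∑-at 𝕜 (deconcatenations-unique c) (++-∈-deconcatenations v w) off)
    (⟦⟧-yes ((v , w) ≟ᵖ (v , w)) refl)
  count c (no ¬p) = Sum.∑-zero 𝕜 (deconcatenations c) (λ ab ab∈ →
    off ab (λ { refl → ¬p (deconcatenations-++ c ab∈) }))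

φ-mul : ∀ x y → φ $ (DNSym-mul $ x $ y) D*.≈ᴹ (φ $ x) DQSym*.· (φ $ y)
φ-mul x y = Free-ext {W = Hom DNSymSpace DQSym*Space} L R
  (λ v → Free-ext {W = DQSym*Space} (L $ gen v) (R $ gen v) (λ w → 𝐌*-++ v w)) x y
  where
  L R : Bilinear DNSymSpace DNSymSpace DQSym*Space
  L = _∘ₗ_ {DNSymSpace} {Hom DNSymSpace DNSymSpace} {Hom DNSymSpace DQSym*Space}
    (postcompose {DNSymSpace} {DNSymSpace} {DQSym*Space} φ) DNSym-mul
  R = _∘ₗ_ {DNSymSpace} {Hom DQSym*Space DQSym*Space} {Hom DNSymSpace DQSym*Space}
    (precompose {DNSymSpace} {DQSym*Space} {DQSym*Space} φ)
    (_∘ₗ_ {DNSymSpace} {DQSym*Space} {Hom DQSym*Space DQSym*Space} DQSym*-mul φ)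

-- The unit and the counit

φ-one : φ $ DNSym.one D*.≈ᴹ DQSym*.one
φ-one = DQSym*-ext (𝐌* []) DQSym*.one λ a →
  trans (⟨𝐌*,𝐌⟩ [] a) (⟦⟧-⇔ ([] ≟ᵇ a) (a ≟ᵇ []) sym sym)

φ-counit : ∀ x → DNSym.counit $ x ≡ DQSym*.counit $ (φ $ x)
φ-counit = Free-ext {W = 𝕜} DNSym.counit (_∘ₗ_ {DNSymSpace} {DQSym*Space} {𝕜} DQSym*.counit φ) on-words
  where
  on-words : ∀ w → DNSym.counit $ gen w ≡ ⟨ 𝐌* w , 𝐌 [] ⟩
  on-words []      = sym (trans (⟨𝐌*,𝐌⟩ [] []) (⟦⟧-yes (_≟ᵇ_ [] []) refl))
  on-words (α ∷ w) = trans
    (cong (_* (DNSym.counit $ gen w)) (⟦⟧-no (value α ≟² 0²) (nonzero α)))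
    (trans (ℚₚ.*-zeroˡ (DNSym.counit $ gen w)) (sym (trans (⟨𝐌*,𝐌⟩ (α ∷ w) []) (⟦⟧-no ((α ∷ w) ≟ᵇ []) (λ ())))))

-- The coproduct

-- As 𝔥 0 = 1, prepending the letter 𝔥 α to a packed word packs α ∷ e, even when α is 0.
𝔥-pack : ∀ α → 𝔥 α ≡ gen (pack (α ∷ []))
𝔥-pack α with α ≟² 0²
... | yes _ = refl
... | no _  = refl

𝔥-∷ : ∀ α e → DNSym-mul $ 𝔥 α $ gen (pack e) ≡ gen (pack (α ∷ e))
𝔥-∷ α e = trans (cong (λ x → DNSym-mul $ x $ gen (pack e)) (𝔥-pack α))
  (cong gen (sym (pack-++ (α ∷ []) e)))

-- The term of the coproduct of a word contributed by the splitting of its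
-- letters into p and q.
split : List ℕ² × List ℕ² → ∥ DNSymSpace ⊗ DNSymSpace ∥
split (p , q) = gen (pack p) ⊗ₑ gen (pack q)

comul-word : ∀ w → DNSym.comul $ gen w AA.≈ᴹ Sum.∑ (DNSymSpace ⊗ DNSymSpace) (splitsᴸ (exponents w)) split
comul-word []      = AA.≈ᴹ-sym (AA.+ᴹ-identityʳ _)
comul-word (α ∷ w) = AA.≈ᴹ-trans
  (Lin.⟦⟧-cong (⊗-mul {DNSymSpace} DNSym-mul $ Δ𝔥 (value α)) (comul-word w))
  (AA.≈ᴹ-trans
    (bilinear-∑ {DNSymSpace ⊗ DNSymSpace} {DNSymSpace ⊗ DNSymSpace} {DNSymSpace ⊗ DNSymSpace}
      (⊗-mul {DNSymSpace} DNSym-mul) (splits (value α)) (λ (β , γ) → 𝔥 β ⊗ₑ 𝔥 γ) (splitsᴸ (exponents w)) split)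
    (AA.≈ᴹ-trans
      (SAA.∑-cong (splits (value α)) (λ (β , γ) → SAA.∑-cong (splitsᴸ (exponents w)) (λ (p , q) →
        AA.≈ᴹ-reflexive (cong₂ _⊗ₑ_ (𝔥-∷ β p) (𝔥-∷ γ q)))))
      (AA.≈ᴹ-sym (SumProperties.∑-cartesianProductWith (DNSymSpace ⊗ DNSymSpace)
        _∷₂_ (splits (value α)) (splitsᴸ (exponents w)) split))))
  where module SAA = Sum (DNSymSpace ⊗ DNSymSpace)

-- The image of split under φ ⊗ φ.
split* : List ℕ² × List ℕ² → ∥ DQSym*Space ⊗ DQSym*Space ∥
split* (p , q) = 𝐌* (pack p) ⊗ₑ 𝐌* (pack q)

-- The coefficient of 𝐌* a ⊗ 𝐌* b is a sum over (p , q) of numbers which are 1 if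
-- a = pack p and b = pack q, and 0 otherwise.  After the two sums are exchanged,
-- the one over (a , b) reduces to the single term a = pack p, b = pack q.
comul-𝐌* : ∀ w → S*.∑ (splitsᴸ (exponents w)) split* DD*.≈ᴹ DQSym*.comul $ 𝐌* w
comul-𝐌* w = DD*.≈ᴹ-sym (DD*.≈ᴹ-trans
  (S*.∑-cong E (λ (a , b) → DD*.≈ᴹ-trans
    (DD*.*ₗ-congʳ (⟨𝐌*,-⟩ w (𝐌 a DQSym.· 𝐌 b)))
    (SumProperties.∑-*ʳ (DQSym*Space ⊗ DQSym*Space) J (λ pq → δ pq (a , b)) (𝐌* a ⊗ₑ 𝐌* b))))
  (DD*.≈ᴹ-trans
    (S*.∑-swap E J (λ ab pq → entry pq ab))
    (SumProperties.∑-cong-∈ (DQSym*Space ⊗ DQSym*Space) J collapse)))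
  where
  n = bound (𝐌* w)
  E = pairs n
  J = splitsᴸ (exponents w)

  -- The summand for (p , q) in the Cauchy product of the series M a and M b.
  δ : List ℕ² × List ℕ² → Bicomposition × Bicomposition → ℚ
  δ (p , q) (a , b) = coeffM a p * coeffM b q

  entry : List ℕ² × List ℕ² → Bicomposition × Bicomposition → ∥ DQSym*Space ⊗ DQSym*Space ∥
  entry pq (a , b) = δ pq (a , b) DD*.*ₗ (𝐌* a ⊗ₑ 𝐌* b)

  δ-≟ : ∀ p q ab → δ (p , q) ab ≡ ⟦ (pack p , pack q) ≟ᵖ ab ⟧
  δ-≟ p q (a , b) = trans (cong₂ _*_ (coeffM-pack a p) (coeffM-pack b q))
    (⟦⟧-× (pack p ≟ᵇ a) (pack q ≟ᵇ b) ((pack p , pack q) ≟ᵖ (a , b))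
      (λ { refl refl → refl }) (cong proj₁) (cong proj₂))

  -- So pack p and pack q have total degree at most n, and (pack p , pack q) occurs in E.
  degrees : ∀ {p q} → (p , q) ∈ J → total (bidegree (pack p)) ℕ.+ total (bidegree (pack q)) ≤ n
  degrees {p} {q} m = ℕₚ.≤-trans (ℕₚ.≤-reflexive (trans
    (sym (total-+² (bidegree (pack p)) (bidegree (pack q))))
    (cong total (trans (cong₂ _+²_ (sum²-pack p) (sum²-pack q)) (splitsᴸ-sum (exponents w) m)))))
    (ℕₚ.n≤1+n (total (bidegree w)))

  collapse : ∀ pq → pq ∈ J → S*.∑ E (entry pq) DD*.≈ᴹ split* pq
  collapse (p , q) m = DD*.≈ᴹ-trans
    (S*.∑-at {is = E} {entry (p , q)} {pack p , pack q} (pairs-unique n)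
      (∈-cartesianProduct⁺
        (∈-bicompositions n (pack p) (ℕₚ.m+n≤o⇒m≤o (total (bidegree (pack p))) (degrees m)))
        (∈-bicompositions n (pack q) (ℕₚ.m+n≤o⇒n≤o (total (bidegree (pack p))) (degrees m))))
      (λ ab ne → DD*.≈ᴹ-trans
        (DD*.*ₗ-congʳ (trans (δ-≟ p q ab) (⟦⟧-no ((pack p , pack q) ≟ᵖ ab) (λ e → ne (sym e)))))
        (DD*.*ₗ-zeroˡ _)))
    (DD*.≈ᴹ-trans
      (DD*.*ₗ-congʳ (trans (δ-≟ p q (pack p , pack q)) (⟦⟧-yes ((pack p , pack q) ≟ᵖ (pack p , pack q)) refl)))
      (DD*.*ₗ-identityˡ _))

φ-comul : ∀ x → tensor {DNSymSpace} {DQSym*Space} {DNSymSpace} {DQSym*Space} φ φ $ (DNSym.comul $ x)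
          DD*.≈ᴹ DQSym*.comul $ (φ $ x)
φ-comul = Free-ext {W = DQSym*Space ⊗ DQSym*Space}
  (_∘ₗ_ {DNSymSpace} {DNSymSpace ⊗ DNSymSpace} {DQSym*Space ⊗ DQSym*Space} φ⊗φ DNSym.comul)
  (_∘ₗ_ {DNSymSpace} {DQSym*Space} {DQSym*Space ⊗ DQSym*Space} DQSym*.comul φ)
  (λ w → DD*.≈ᴹ-trans (Lin.⟦⟧-cong φ⊗φ (comul-word w))
    (DD*.≈ᴹ-trans (linear-∑ {DNSymSpace ⊗ DNSymSpace} {DQSym*Space ⊗ DQSym*Space} φ⊗φ (splitsᴸ (exponents w)) split)
      (comul-𝐌* w)))
  where
  φ⊗φ : DNSymSpace ⊗ DNSymSpace ⊸ DQSym*Space ⊗ DQSym*Space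
  φ⊗φ = tensor {DNSymSpace} {DQSym*Space} {DNSymSpace} {DQSym*Space} φ φ

-- The bigrading

-- The series 𝐌 b has zero coefficient at exponents whose sum is not the bidegree of b.
φ-component : ∀ {d x} → DNSym.Component d x → DQSym*.Component d (φ $ x)
φ-component {d} p d′ d′≢d (y , y∈) = linear-span {DNSymSpace} {𝕜}
  (_∘ₗ_ {DNSymSpace} {DQSym*Space} {𝕜} evaluate-y φ) (zero-map {DNSymSpace} {𝕜})
  (λ (w , w-degree) → linear-span {DQSymSpace} {𝕜} (coordinate w) (zero-map {DQSymSpace} {𝕜})
    (λ (b , b-degree) → coeffM-degree b (exponents w)
      (λ eq → d′≢d (trans (sym b-degree) (trans (sym eq) w-degree)))) y∈) p
  where
  evaluate-y : DQSym*Space ⊸ 𝕜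
  evaluate-y = linear {DQSym*Space} {𝕜} (λ f → at f d′ $ (y , y∈))
    (λ p → p d′ (y , y∈)) (λ _ _ → refl) (λ _ _ → refl)

ψ-component : ∀ {d f} → DQSym*.Component d f → DNSym.Component d (ψ $ f)
ψ-component {d} {f} f∈ = sum∈ (bicompositions (bound f))
  where
  term∈ : ∀ a → Dec (bidegree a ≡ d) → DNSym.Component d (ψ-term f a)
  term∈ a (yes p) = scale ⟨ f , 𝐌 a ⟩ (gen (a , p))
  term∈ a (no ¬p) = respect (A.≈ᴹ-sym (A.≈ᴹ-trans
    (A.*ₗ-congʳ (f∈ (bidegree a) ¬p (𝐌 a , gen (a , refl)))) (A.*ₗ-zeroˡ (gen a)))) zero
  sum∈ : ∀ as → DNSym.Component d (SA.∑ as (ψ-term f))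
  sum∈ []       = zero
  sum∈ (a ∷ as) = add (term∈ a (bidegree a ≟² d)) (sum∈ as)

theorem3p1 : DNSym ≅ DQSym*
theorem3p1 = record
  { φ              = φ
  ; isIsomorphism  = record
    { isModuleMonomorphism = record
      { isModuleHomomorphism = _⊸_.isLinear φ
      ; injective = λ {x} {y} p → A.≈ᴹ-trans (A.≈ᴹ-sym (ψ∘φ x))
          (A.≈ᴹ-trans (Lin.⟦⟧-cong ψ {φ $ x} {φ $ y} p) (ψ∘φ y)) }
    ; surjective = λ f → ψ $ f , λ {x} p →
        D*.≈ᴹ-trans {φ $ x} {φ $ (ψ $ f)} {f} (Lin.⟦⟧-cong φ p) (φ∘ψ f) }
  ; mul-homo       = φ-mul
  ; one-homo       = φ-one
  ; comul-homo     = φ-comul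
  ; counit-homo    = φ-counit
  ; component-homo = λ d x → mk⇔ φ-component
      (λ p → respect (ψ∘φ x) (ψ-component {d} {φ $ x} p))
  }
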